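{- Let $\alpha$ be a dotted composition and let $S$ be the antipode of ${\rm sQSym}$. Then $$S(M_\alpha)=(-1)^{\ell(\alpha)+\binom{m_\alpha}{2}}\sum_{\gamma\,\trianglerighteq\,\operatorname{rev}(\alpha)}M_\gamma,$$ where $m_\alpha$ is the fermionic degree of $\alpha$ and $\operatorname{rev}(\alpha)$ is the reverse of $\alpha$.
   Context: Variables $x_1,x_2,\dots$ commute; $\theta_1,\theta_2,\dots$ anticommute ($\theta_i\theta_j=-\theta_j\theta_i$, $\theta_i^2=0$). A dotted composition $\alpha=(\alpha_1,\dots,\alpha_l)$ is a finite (possibly empty) sequence whose entries belong to $\{1,2,3,\dots\}$ (non-dotted) or $\{\dot0,\dot1,\dot2,\dots\}$ (dotted). Its length is $\ell(\alpha)=l$, its fermionic degree $m_\alpha$ is its number of dotted parts, and $\operatorname{rev}(\alpha)=(\alpha_l,\dots,\alpha_1)$. Put $\eta_i=1$ if $\alpha_i$ is dotted and $\eta_i=0$ otherwise. ${\rm sQSym}$ is the $\mathbb Q$-algebra of bounded-degree formal power series $f$ in these variables such that, for every dotted composition $\alpha$, all monomials $\theta_{i_1}^{\eta_1}\cdots\theta_{i_l}^{\eta_l}x_{i_1}^{\alpha_1}\cdots x_{i_l}^{\alpha_l}$ with $i_1<\cdots<i_l$ have the same coefficient in $f$ (dots ignored in exponents). It has the basis $M_\alpha=\sum_{i_1<\cdots<i_l}\theta_{i_1}^{\eta_1}\cdots\theta_{i_l}^{\eta_l}x_{i_1}^{\alpha_1}\cdots x_{i_l}^{\alpha_l}$,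 with $M_\emptyset=1$. The partial order $\trianglelefteq$ on dotted compositions is the reflexive and transitive closure of the covering relation: $\beta\trianglelefteq\alpha$ if $\alpha$ is obtained from $\beta$ by adding together two adjacent parts of $\beta$ that are not both dotted; the sum of a dotted part and a non-dotted part is dotted. $\gamma\trianglerighteq\beta$ means $\beta\trianglelefteq\gamma$. Hopf structure: ${\rm sQSym}\otimes{\rm sQSym}$ is identified with functions, quasisymmetric in each set, of two sets of variables $(x;\theta)$, $(y;\phi)$, ordered by $x_1<x_2<\cdots<y_1<y_2<\cdots$ and $\theta_1<\theta_2<\cdots<\phi_1<\phi_2<\cdots$, with the $\theta$'s and $\phi$'s anticommuting; $f\otimes g$ corresponds to $f(x;\theta)g(y;\phi)$. The coproduct is $(\Delta f)(x,y;\theta,\phi)=f(x,y;\theta,\phi)$, i.e. $f$ evaluated on the ordered union of the two sets of variables. The counit $\epsilon$ sends $1$ to $1$ and $M_\alpha$ to $0$ for $\alpha\ne\emptyset$. The antipode $S$ is the unique linear map with $\mathrm{mult}\circ(S\otimes1)\circ\Delta=u\circ\epsilon=\mathrm{mult}\circ(1\otimes S)\circ\Delta$ ($\mathrm{mult}$ the multiplication, $u$ the unit map). -}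

module Defs where

import Algebra.Definitions.RawSemiring as RawSemiringDefs
open import Algebra.Module.Bundles using (LeftModule)
import Algebra.Module.Morphism.Structures as ModuleMorphisms
open import Data.Bool using (Bool; true; false; if_then_else_)
open import Data.List
  using (List; []; _∷_; _++_; map; foldr; length; filter; filterᵇ; concatMap; mapMaybe; applyUpTo)
open import Data.List.Membership.Propositional using (_∈_)
open import Data.List.Membership.Propositional.Properties
  using (∈-map⁺; ∈-map⁻; ∈-++⁺ˡ; ∈-++⁺ʳ; ∈-++⁻)
import Data.List.Properties as ListP
open import Data.List.Relation.Unary.All as All using (All; []; _∷_)
import Data.List.Relation.Unary.All.Properties as AllP
open import Data.List.Relation.Unary.AllPairs using ([]; _∷_)
open import Data.List.Relation.Unary.Any using (here; there)
open import Data.List.Relation.Unary.Unique.Propositional using (Unique)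
import Data.List.Relation.Unary.Unique.Propositional.Properties as UniqueP
open import Data.List.Relation.Binary.Pointwise as Pointwise using (Pointwise; []; _∷_)
open import Data.Maybe as Maybe using (Maybe; just; nothing)
import Data.Maybe.Properties as MaybeP
open import Data.Nat as ℕ using (ℕ; zero; suc; NonZero; _≤_; _<_; _<?_; _≤?_; _∸_)
open import Data.Nat.ListAction using (sum)
import Data.Nat.Properties as ℕP
open import Data.Nat.Solver using (module +-*-Solver)
open import Data.Product as Product using (∃; _×_; _,_; proj₁; proj₂)
open import Data.Rational as ℚ using (ℚ; 0ℚ; 1ℚ)
import Data.Rational.Properties as ℚP
open import Data.Sum using (_⊎_; inj₁; inj₂)
open import Function using (_∘_; id; _⇔_; mk⇔)
open import Level using (0ℓ)
open import Relation.Binary.Construct.Closure.ReflexiveTransitive as Star using (Star; ε; _◅_; _◅◅_)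
open import Relation.Binary.Definitions using (DecidableEquality)
open import Relation.Binary.PropositionalEquality
  using (_≡_; _≢_; refl; sym; trans; cong; cong₂; subst)
open import Relation.Nullary using (¬_; yes; no; does; contradiction; recompute)

open RawSemiringDefs ℚ.+-*-rawSemiring public using (_^_)

data Part : Set where
  plain  : (a : ℕ) → .⦃ NonZero a ⦄ → Part
  dotted : ℕ → Part

isDotted : Part → Bool
isDotted (plain _)  = false
isDotted (dotted _) = true

DottedComposition : Set
DottedComposition = List Part

fermionicDegree : DottedComposition → ℕ
fermionicDegree α = length (filterᵇ isDotted α)

infix 4 _≟_
_≟_ : DecidableEquality Part
plain a ≟ plain b with a ℕ.≟ b
... | yes refl = yes refl
... | no  a≢b  = no λ { refl → a≢b refl }
dotted a ≟ dotted b with a ℕ.≟ b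
... | yes refl = yes refl
... | no  a≢b  = no λ { refl → a≢b refl }
plain _  ≟ dotted _ = no λ ()
dotted _ ≟ plain _  = no λ ()

plus-nonZero : ∀ a b → .⦃ NonZero a ⦄ → NonZero (a ℕ.+ b)
plus-nonZero (suc _) _ = _

infixr 6 _⊕_
_⊕_ : Part → Part → Maybe Part
plain a  ⊕ plain b  = just (plain (a ℕ.+ b) ⦃ plus-nonZero a b ⦄)
plain a  ⊕ dotted b = just (dotted (a ℕ.+ b))
dotted a ⊕ plain b  = just (dotted (a ℕ.+ b))
dotted _ ⊕ dotted _ = nothing

infix 4 _⋖_ _⊴_
data _⋖_ : DottedComposition → DottedComposition → Set where
  merge : ∀ δ p q r ζ → p ⊕ q ≡ just r → (δ ++ p ∷ q ∷ ζ) ⋖ (δ ++ r ∷ ζ)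

_⊴_ : DottedComposition → DottedComposition → Set
_⊴_ = Star _⋖_

record Enumeration {A : Set} (P : A → Set) : Set where
  field
    elements : List A
    unique   : Unique elements
    complete : ∀ x → x ∈ elements ⇔ P x

mergeHead : Part → DottedComposition → Maybe DottedComposition
mergeHead p []      = nothing
mergeHead p (q ∷ γ) = Maybe.map (_∷ γ) (p ⊕ q)

coarsenings : DottedComposition → List DottedComposition
coarsenings []      = [] ∷ []
coarsenings (p ∷ β) = map (p ∷_) (coarsenings β) ++ mapMaybe (mergeHead p) (coarsenings β)

plain-cong : ∀ {a b} .{x : NonZero a} .{y : NonZero b} → a ≡ b → plain a ⦃ x ⦄ ≡ plain b ⦃ y ⦄
plain-cong refl = refl

plain-inj : ∀ {a b} .{x : NonZero a} .{y : NonZero b} → plain a ⦃ x ⦄ ≡ plain b ⦃ y ⦄ → a ≡ b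
plain-inj refl = refl

dotted-inj : ∀ {a b} → dotted a ≡ dotted b → a ≡ b
dotted-inj refl = refl

⊕≢ˡ : ∀ p q → p ⊕ q ≢ just p
⊕≢ˡ (plain a)  (plain b@(suc _)) eq =
  ℕP.m+1+n≢m a (plain-inj (MaybeP.just-injective eq))
⊕≢ˡ (plain a)  (dotted b)        ()
⊕≢ˡ (dotted a) (plain b@(suc _)) eq =
  ℕP.m+1+n≢m a (dotted-inj (MaybeP.just-injective eq))
⊕≢ˡ (dotted _) (dotted _)        ()

⊕-cancelˡ : ∀ p q q′ {r} → p ⊕ q ≡ just r → p ⊕ q′ ≡ just r → q ≡ q′
⊕-cancelˡ (plain a) (plain b) (plain c) eq eq′ =
  plain-cong (ℕP.+-cancelˡ-≡ a b c (plain-inj (MaybeP.just-injective (trans eq (sym eq′)))))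
⊕-cancelˡ (plain a) (dotted b) (dotted c) eq eq′ =
  cong dotted (ℕP.+-cancelˡ-≡ a b c (dotted-inj (MaybeP.just-injective (trans eq (sym eq′)))))
⊕-cancelˡ (plain a) (plain b) (dotted c) refl ()
⊕-cancelˡ (plain a) (dotted b) (plain c) refl ()
⊕-cancelˡ (dotted a) (plain b) (plain c) eq eq′ =
  plain-cong (ℕP.+-cancelˡ-≡ a b c (dotted-inj (MaybeP.just-injective (trans eq (sym eq′)))))

⊕-assoc : ∀ p q s {r t} → p ⊕ q ≡ just r → r ⊕ s ≡ just t →
          ∃ λ u → q ⊕ s ≡ just u × p ⊕ u ≡ just t
⊕-assoc (plain a)  (plain b)  (plain c)  refl refl =
  _ , refl , cong just (plain-cong (sym (ℕP.+-assoc a b c)))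
⊕-assoc (plain a)  (plain b)  (dotted c) refl refl =
  _ , refl , cong (just ∘ dotted) (sym (ℕP.+-assoc a b c))
⊕-assoc (plain a)  (dotted b) (plain c)  refl refl =
  _ , refl , cong (just ∘ dotted) (sym (ℕP.+-assoc a b c))
⊕-assoc (dotted a) (plain b)  (plain c)  refl refl =
  _ , refl , cong (just ∘ dotted) (sym (ℕP.+-assoc a b c))

mergeHead⁻ : ∀ p γ {δ} → mergeHead p γ ≡ just δ →
             ∃ λ q → ∃ λ γ′ → ∃ λ r → γ ≡ q ∷ γ′ × p ⊕ q ≡ just r × δ ≡ r ∷ γ′
mergeHead⁻ p (q ∷ γ) eq with p ⊕ q in pq
mergeHead⁻ p (q ∷ γ) refl | just r = q , γ , r , refl , pq , refl

mergeHead⁺ : ∀ p q γ {r} → p ⊕ q ≡ just r → mergeHead p (q ∷ γ) ≡ just (r ∷ γ)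
mergeHead⁺ p q γ eq = cong (Maybe.map (_∷ γ)) eq

mergeHead-injective : ∀ p γ γ′ {δ} → mergeHead p γ ≡ just δ → mergeHead p γ′ ≡ just δ → γ ≡ γ′
mergeHead-injective p γ γ′ eq eq′ with mergeHead⁻ p γ eq | mergeHead⁻ p γ′ eq′
... | q , ζ , r , refl , pq , refl | q′ , .ζ , .r , refl , pq′ , refl =
  cong (_∷ ζ) (⊕-cancelˡ p q q′ pq pq′)

module _ {A B : Set} (f : A → Maybe B) where

  ∈-mapMaybe⁺ : ∀ {x y xs} → x ∈ xs → f x ≡ just y → y ∈ mapMaybe f xs
  ∈-mapMaybe⁺ {xs = x ∷ xs} (here refl) eq with f x
  ∈-mapMaybe⁺ {xs = x ∷ xs} (here refl) refl | just _ = here refl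
  ∈-mapMaybe⁺ {xs = x ∷ xs} (there i) eq with f x
  ... | just _  = there (∈-mapMaybe⁺ i eq)
  ... | nothing = ∈-mapMaybe⁺ i eq

  ∈-mapMaybe⁻ : ∀ {y} xs → y ∈ mapMaybe f xs → ∃ λ x → x ∈ xs × f x ≡ just y
  ∈-mapMaybe⁻ (x ∷ xs) i with f x in eq
  ∈-mapMaybe⁻ (x ∷ xs) (here refl) | just _ = x , here refl , eq
  ∈-mapMaybe⁻ (x ∷ xs) (there i) | just _ = Product.map₂ (Product.map₁ there) (∈-mapMaybe⁻ xs i)
  ∈-mapMaybe⁻ (x ∷ xs) i | nothing = Product.map₂ (Product.map₁ there) (∈-mapMaybe⁻ xs i)

  mapMaybe-unique : (∀ {x x′ y} → f x ≡ just y → f x′ ≡ just y → x ≡ x′) →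
                    ∀ {xs} → Unique xs → Unique (mapMaybe f xs)
  mapMaybe-unique inj [] = []
  mapMaybe-unique inj {x ∷ xs} (x∉ ∷ u) with f x in eq
  ... | nothing = mapMaybe-unique inj u
  ... | just y  = All.tabulate fresh ∷ mapMaybe-unique inj u
    where
    fresh : ∀ {z} → z ∈ mapMaybe f xs → y ≢ z
    fresh i refl with ∈-mapMaybe⁻ xs i
    ... | x′ , x′∈ , eq′ = All.lookup x∉ x′∈ (inj eq eq′)

coarsenings-unique : ∀ β → Unique (coarsenings β)
coarsenings-unique []      = [] ∷ []
coarsenings-unique (p ∷ β) =
  UniqueP.++⁺ (UniqueP.map⁺ ListP.∷-injectiveʳ (coarsenings-unique β))
    (mapMaybe-unique (mergeHead p) (λ {γ} {γ′} → mergeHead-injective p γ γ′) (coarsenings-unique β))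
    disjoint
  where
  disjoint : ∀ {γ} → ¬ (γ ∈ map (p ∷_) (coarsenings β) × γ ∈ mapMaybe (mergeHead p) (coarsenings β))
  disjoint (i , j) with ∈-map⁻ (p ∷_) i | ∈-mapMaybe⁻ (mergeHead p) (coarsenings β) j
  ... | _ , _ , refl | γ , _ , eq with mergeHead⁻ p γ eq
  ... | q , _ , _ , _ , pq , refl = ⊕≢ˡ p q pq

∷-⊴ : ∀ p {β γ} → β ⊴ γ → (p ∷ β) ⊴ (p ∷ γ)
∷-⊴ p = Star.gmap (p ∷_) λ { (merge δ q r s ζ eq) → merge (p ∷ δ) q r s ζ eq }

coarsenings-sound : ∀ β {γ} → γ ∈ coarsenings β → β ⊴ γ
coarsenings-sound []      (here refl) = ε
coarsenings-sound (p ∷ β) i with ∈-++⁻ (map (p ∷_) (coarsenings β)) i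
... | inj₁ j with ∈-map⁻ (p ∷_) j
...   | γ , k , refl = ∷-⊴ p (coarsenings-sound β k)
coarsenings-sound (p ∷ β) i | inj₂ j with ∈-mapMaybe⁻ (mergeHead p) (coarsenings β) j
... | γ , k , eq with mergeHead⁻ p γ eq
... | q , γ′ , r , refl , pq , refl =
  ∷-⊴ p (coarsenings-sound β k) ◅◅ merge [] p q r γ′ pq ◅ ε

coarsenings-∷ : ∀ p β {γ} → γ ∈ coarsenings β → (p ∷ γ) ∈ coarsenings (p ∷ β)
coarsenings-∷ p β i = ∈-++⁺ˡ (∈-map⁺ (p ∷_) i)

coarsenings-merge : ∀ p β {q γ r} → (q ∷ γ) ∈ coarsenings β → p ⊕ q ≡ just r →
                    (r ∷ γ) ∈ coarsenings (p ∷ β)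
coarsenings-merge p β {q} {γ} i pq =
  ∈-++⁺ʳ (map (p ∷_) (coarsenings β)) (∈-mapMaybe⁺ (mergeHead p) i (mergeHead⁺ p q γ pq))

coarsenings-refl : ∀ β → β ∈ coarsenings β
coarsenings-refl []      = here refl
coarsenings-refl (p ∷ β) = coarsenings-∷ p β (coarsenings-refl β)

coarsenings-step : ∀ δ p q {r} ζ {γ} → p ⊕ q ≡ just r →
  γ ∈ coarsenings (δ ++ r ∷ ζ) → γ ∈ coarsenings (δ ++ p ∷ q ∷ ζ)
coarsenings-step [] p q {r} ζ pq i with ∈-++⁻ (map (r ∷_) (coarsenings ζ)) i
... | inj₁ j with ∈-map⁻ (r ∷_) j
...   | γ , k , refl = coarsenings-merge p (q ∷ ζ) (coarsenings-∷ q ζ k) pq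
coarsenings-step [] p q {r} ζ pq i | inj₂ j with ∈-mapMaybe⁻ (mergeHead r) (coarsenings ζ) j
... | γ , k , eq with mergeHead⁻ r γ eq
... | s , γ′ , t , refl , rs , refl with ⊕-assoc p q s pq rs
... | u , qs , pu = coarsenings-merge p (q ∷ ζ) (coarsenings-merge q ζ k qs) pu
coarsenings-step (s ∷ δ) p q {r} ζ pq i
  with ∈-++⁻ (map (s ∷_) (coarsenings (δ ++ r ∷ ζ))) i
... | inj₁ j with ∈-map⁻ (s ∷_) j
...   | γ , k , refl = coarsenings-∷ s (δ ++ p ∷ q ∷ ζ) (coarsenings-step δ p q ζ pq k)
coarsenings-step (s ∷ δ) p q {r} ζ pq i | inj₂ j
  with ∈-mapMaybe⁻ (mergeHead s) (coarsenings (δ ++ r ∷ ζ)) j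
... | γ , k , eq with mergeHead⁻ s γ eq
... | t , γ′ , u , refl , st , refl =
  coarsenings-merge s (δ ++ p ∷ q ∷ ζ) (coarsenings-step δ p q ζ pq k) st

coarsenings-complete : ∀ {β γ} → β ⊴ γ → γ ∈ coarsenings β
coarsenings-complete {β} ε = coarsenings-refl β
coarsenings-complete (merge δ p q r ζ pq ◅ st) =
  coarsenings-step δ p q ζ pq (coarsenings-complete st)

-- The finite set { γ | β ⊴ γ }, listed without repetition.
above : ∀ β → Enumeration (β ⊴_)
above β = record
  { elements = coarsenings β
  ; unique   = coarsenings-unique β
  ; complete = λ γ → mk⇔ (coarsenings-sound β) coarsenings-complete
  }

-- A monomial in the variables θₖ, xₖ, θₖ₊₁, xₖ₊₁, …, written uniquely as
-- θ_{i₁}^{η₁} ⋯ θ_{iₗ}^{ηₗ} x_{i₁}^{α₁} ⋯ x_{iₗ}^{αₗ} with k ≤ i₁ < ⋯ < iₗ, where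
-- (αⱼ, ηⱼ) ≠ (0, 0).  The exponents of θᵢ and xᵢ together form a part: plain a
-- stands for xᵢᵃ and dotted a for θᵢ xᵢᵃ.
data Monomial (k : ℕ) : Set where
  one    : Monomial k
  factor : (i : ℕ) → .(k ≤ i) → Part → Monomial (suc i) → Monomial k

shape : ∀ {k} → Monomial k → DottedComposition
shape one              = []
shape (factor _ _ p m) = p ∷ shape m

weight : Part → ℕ
weight (plain a)  = a
weight (dotted a) = suc a

degree : ∀ {k} → Monomial k → ℕ
degree m = sum (map weight (shape m))

thetas : ∀ {k} → Monomial k → List ℕ
thetas one                       = []
thetas (factor _ _ (plain _)  m) = thetas m
thetas (factor i _ (dotted _) m) = i ∷ thetas m

weaken : ∀ {j k} → .(j ≤ k) → Monomial k → Monomial j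
weaken j≤k one                = one
weaken j≤k (factor i k≤i p m) = factor i (ℕP.≤-trans j≤k k≤i) p m

optFactor : ∀ {k} (i : ℕ) → .(k ≤ i) → Maybe Part → Monomial (suc i) → Monomial k
optFactor i k≤i nothing  m = weaken (ℕP.m≤n⇒m≤1+n k≤i) m
optFactor i k≤i (just p) m = factor i k≤i p m

-- The monomial of shape α in the variables with consecutive indices k, k+1, ….
consecutive : ∀ k → DottedComposition → Monomial k
consecutive k []      = one
consecutive k (p ∷ α) = factor k ℕP.≤-refl p (consecutive (suc k) α)

shape-consecutive : ∀ k α → shape (consecutive k α) ≡ α
shape-consecutive k []      = refl
shape-consecutive k (p ∷ α) = cong (p ∷_) (shape-consecutive (suc k) α)

antidiagonal : ℕ → List (ℕ × ℕ)
antidiagonal a = applyUpTo (λ b → b , a ∸ b) (suc a)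

plain? : ℕ → Maybe Part
plain? zero    = nothing
plain? (suc a) = just (plain (suc a))

-- All ways to distribute the exponents of θᵢ and xᵢ over two factors; nothing
-- means that neither variable occurs.
splits : Part → List (Maybe Part × Maybe Part)
splits (plain a)  = map (λ (b , c) → plain? b , plain? c) (antidiagonal a)
splits (dotted a) = map (λ (b , c) → just (dotted b) , plain? c) (antidiagonal a)
                 ++ map (λ (b , c) → plain? b , just (dotted c)) (antidiagonal a)

-- All pairs (m₁ , m₂) with m₁ m₂ = ± m.
factorizations : ∀ {k} → Monomial k → List (Monomial k × Monomial k)
factorizations one                = (one , one) ∷ []
factorizations (factor i k≤i p m) =
  concatMap (λ (p₁ , p₂) →
    map (λ (m₁ , m₂) → optFactor i k≤i p₁ m₁ , optFactor i k≤i p₂ m₂) (factorizations m))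
    (splits p)

-- The number of pairs (a , b) in I × J with a > b.
inversions : List ℕ → List ℕ → ℕ
inversions I J = sum (map (λ b → length (filter (b <?_) I)) J)

-- m₁ m₂ = signOf m₁ m₂ · m whenever (m₁ , m₂) is a factorization of m, since
-- θ_I θ_J = (-1)^(inversions I J) θ_{I ∪ J} for disjoint I and J.
signOf : ∀ {k} → Monomial k → Monomial k → ℚ
signOf m₁ m₂ = (ℚ.- 1ℚ) ^ inversions (thetas m₁) (thetas m₂)

Series : ℕ → Set
Series k = Monomial k → ℚ

∑ℚ : List ℚ → ℚ
∑ℚ = foldr ℚ._+_ 0ℚ

infixl 7 _⋆_
_⋆_ : ∀ {k} → Series k → Series k → Series k
(f ⋆ g) m = ∑ℚ (map (λ (m₁ , m₂) → signOf m₁ m₂ ℚ.* (f m₁ ℚ.* g m₂)) (factorizations m))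

-- The degree counts the θ's as well as the x's: otherwise infinite sums of M α with
-- all parts of α equal to dotted 0 would have bounded degree.
HasBoundedDegree : Series 1 → Set
HasBoundedDegree f = ∃ λ d → ∀ m → d < degree m → f m ≡ 0ℚ

IsQuasisymmetric : Series 1 → Set
IsQuasisymmetric f = ∀ m m′ → shape m ≡ shape m′ → f m ≡ f m′

record sQSym : Set where
  field
    coeff          : Series 1
    bounded        : HasBoundedDegree coeff
    quasisymmetric : IsQuasisymmetric coeff

open sQSym public

infix 4 _≈_
_≈_ : sQSym → sQSym → Set
f ≈ g = ∀ m → coeff f m ≡ coeff g m

weight-plain? : ∀ a → Maybe.maybe′ weight 0 (plain? a) ≡ a
weight-plain? zero    = refl
weight-plain? (suc a) = refl

weight? : Maybe Part → ℕ
weight? = Maybe.maybe′ weight 0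

antidiagonal-sum : ∀ a → All (λ (b , c) → b ℕ.+ c ≡ a) (antidiagonal a)
antidiagonal-sum a = AllP.applyUpTo⁺₁ (λ b → b , a ∸ b) (suc a) λ {b} b<1+a → ℕP.m+[n∸m]≡n (ℕP.≤-pred b<1+a)

splits-weight : ∀ p → All (λ (p₁ , p₂) → weight? p₁ ℕ.+ weight? p₂ ≡ weight p) (splits p)
splits-weight (plain a) = AllP.map⁺ (All.map
  (λ {(b , c)} eq → trans (cong₂ ℕ._+_ (weight-plain? b) (weight-plain? c)) eq) (antidiagonal-sum a))
splits-weight (dotted a) = AllP.++⁺
  (AllP.map⁺ (All.map
    (λ {(b , c)} eq → cong suc (trans (cong (b ℕ.+_) (weight-plain? c)) eq)) (antidiagonal-sum a)))
  (AllP.map⁺ (All.map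
    (λ {(b , c)} eq → trans (ℕP.+-suc _ c) (cong suc (trans (cong (ℕ._+ c) (weight-plain? b)) eq)))
    (antidiagonal-sum a)))

shape-weaken : ∀ {j k} .(j≤k : j ≤ k) m → shape (weaken j≤k m) ≡ shape m
shape-weaken _ one              = refl
shape-weaken _ (factor _ _ _ _) = refl

thetas-weaken : ∀ {j k} .(j≤k : j ≤ k) m → thetas (weaken j≤k m) ≡ thetas m
thetas-weaken _ one                       = refl
thetas-weaken _ (factor _ _ (plain _) _)  = refl
thetas-weaken _ (factor _ _ (dotted _) _) = refl

shape-optFactor : ∀ {k} i .(k≤i : k ≤ i) p m →
                  shape (optFactor i k≤i p m) ≡ Maybe.maybe′ _∷_ id p (shape m)
shape-optFactor i k≤i nothing  m = shape-weaken (ℕP.m≤n⇒m≤1+n k≤i) m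
shape-optFactor i k≤i (just _) m = refl

degree-optFactor : ∀ {k} i .(k≤i : k ≤ i) p m →
                   degree (optFactor i k≤i p m) ≡ weight? p ℕ.+ degree m
degree-optFactor i k≤i nothing  m = cong (sum ∘ map weight) (shape-weaken (ℕP.m≤n⇒m≤1+n k≤i) m)
degree-optFactor i k≤i (just _) m = refl

factorizations-degree : ∀ {k} (m : Monomial k) →
  All (λ (m₁ , m₂) → degree m₁ ℕ.+ degree m₂ ≡ degree m) (factorizations m)
factorizations-degree one = refl ∷ []
factorizations-degree (factor i k≤i p m) = AllP.concat⁺ (AllP.map⁺ (All.map
  (λ {(p₁ , p₂)} eqp → AllP.map⁺ (All.map
    (λ {(m₁ , m₂)} eqm → trans
      (cong₂ ℕ._+_ (degree-optFactor i k≤i p₁ m₁) (degree-optFactor i k≤i p₂ m₂))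
      (trans (interchange (weight? p₁) (degree m₁) (weight? p₂) (degree m₂))
             (cong₂ ℕ._+_ eqp eqm)))
    (factorizations-degree m)))
  (splits-weight p)))
  where
  interchange : ∀ a b c d → (a ℕ.+ b) ℕ.+ (c ℕ.+ d) ≡ (a ℕ.+ c) ℕ.+ (b ℕ.+ d)
  interchange = solve 4 (λ a b c d → (a :+ b) :+ (c :+ d) := (a :+ c) :+ (b :+ d)) refl
    where open +-*-Solver

thetas-above : ∀ {k} (m : Monomial k) → All (k ≤_) (thetas m)
thetas-above one = []
thetas-above {k} (factor i k≤i (plain _) m) =
  All.map (ℕP.≤-trans (ℕP.m≤n⇒m≤1+n (recompute (k ≤? i) k≤i))) (thetas-above m)
thetas-above {k} (factor i k≤i (dotted _) m) =
  recompute (k ≤? i) k≤i ∷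
  All.map (ℕP.≤-trans (ℕP.m≤n⇒m≤1+n (recompute (k ≤? i) k≤i))) (thetas-above m)

isDotted? : Maybe Part → Bool
isDotted? = Maybe.maybe′ isDotted false

consIf : Bool → ℕ → List ℕ → List ℕ
consIf b i I = if b then i ∷ I else I

thetas-optFactor : ∀ {k} i .(k≤i : k ≤ i) p m →
                   thetas (optFactor i k≤i p m) ≡ consIf (isDotted? p) i (thetas m)
thetas-optFactor i k≤i nothing           m = thetas-weaken (ℕP.m≤n⇒m≤1+n k≤i) m
thetas-optFactor i k≤i (just (plain _))  m = refl
thetas-optFactor i k≤i (just (dotted _)) m = refl

inversions-consˡ : ∀ i I J → All (i <_) J → inversions (i ∷ I) J ≡ inversions I J
inversions-consˡ i I []      []          = refl
inversions-consˡ i I (j ∷ J) (i<j ∷ i<J) = cong₂ ℕ._+_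
  (cong length (ListP.filter-reject (j <?_) {xs = I} (ℕP.<⇒≯ i<j))) (inversions-consˡ i I J i<J)

length-thetas : ∀ {k} (m : Monomial k) → length (thetas m) ≡ fermionicDegree (shape m)
length-thetas one                       = refl
length-thetas (factor _ _ (plain _) m)  = length-thetas m
length-thetas (factor _ _ (dotted _) m) = cong suc (length-thetas m)

inversions-cons : ∀ b c i I J → All (i <_) I → All (i <_) J → (b ≡ false ⊎ c ≡ false) →
  inversions (consIf b i I) (consIf c i J) ≡ (if c then length I else 0) ℕ.+ inversions I J
inversions-cons false false i I J i<I i<J _ = refl
inversions-cons true  false i I J i<I i<J _ = inversions-consˡ i I J i<J
inversions-cons false true  i I J i<I i<J _ =
  cong (λ l → length l ℕ.+ inversions I J) (ListP.filter-all (i <?_) i<I)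
inversions-cons true  true  i I J i<I i<J (inj₁ ())
inversions-cons true  true  i I J i<I i<J (inj₂ ())

isDotted-plain? : ∀ a → isDotted? (plain? a) ≡ false
isDotted-plain? zero    = refl
isDotted-plain? (suc _) = refl

splits-dots : ∀ p → All (λ (p₁ , p₂) → isDotted? p₁ ≡ false ⊎ isDotted? p₂ ≡ false) (splits p)
splits-dots (plain a) = AllP.map⁺ (All.universal (λ (b , _) → inj₁ (isDotted-plain? b)) (antidiagonal a))
splits-dots (dotted a) = AllP.++⁺
  (AllP.map⁺ (All.universal (λ (_ , c) → inj₂ (isDotted-plain? c)) (antidiagonal a)))
  (AllP.map⁺ (All.universal (λ (b , _) → inj₁ (isDotted-plain? b)) (antidiagonal a)))

SameFactorization : ∀ {j k} → Monomial j × Monomial j → Monomial k × Monomial k → Set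
SameFactorization (m₁ , m₂) (n₁ , n₂) =
  shape m₁ ≡ shape n₁ × shape m₂ ≡ shape n₂ ×
  inversions (thetas m₁) (thetas m₂) ≡ inversions (thetas n₁) (thetas n₂)

concatMap-pointwise : {A B D : Set} {R : B → D → Set} {Q : A → Set}
  {f : A → List B} {g : A → List D} {xs : List A} →
  (∀ {x} → Q x → Pointwise R (f x) (g x)) → All Q xs →
  Pointwise R (concatMap f xs) (concatMap g xs)
concatMap-pointwise h []       = []
concatMap-pointwise h (q ∷ qs) = Pointwise.++⁺ (h q) (concatMap-pointwise h qs)

factorizations-shape : ∀ {j k} (m : Monomial j) (n : Monomial k) → shape m ≡ shape n →
  Pointwise SameFactorization (factorizations m) (factorizations n)
factorizations-shape one one _ = (refl , refl , refl) ∷ []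
factorizations-shape (factor i j≤i p m) (factor i′ k≤i′ _ n) eq with ListP.∷-injective eq
... | refl , eqs = concatMap-pointwise
  (λ {(p₁ , p₂)} dots → Pointwise.map⁺ (assemble i j≤i p₁ p₂) (assemble i′ k≤i′ p₁ p₂)
    (Pointwise.map (λ {(m₁ , m₂)} {(n₁ , n₂)} (s₁ , s₂ , s₃) →
        trans (shape-optFactor i j≤i p₁ m₁) (trans (cong (Maybe.maybe′ _∷_ id p₁) s₁)
          (sym (shape-optFactor i′ k≤i′ p₁ n₁)))
      , trans (shape-optFactor i j≤i p₂ m₂) (trans (cong (Maybe.maybe′ _∷_ id p₂) s₂)
          (sym (shape-optFactor i′ k≤i′ p₂ n₂)))
      , trans (inversions-step i j≤i p₁ p₂ m₁ m₂ dots)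
          (trans (cong₂ (λ l s → (if isDotted? p₂ then l else 0) ℕ.+ s)
                    (trans (length-thetas m₁)
                      (trans (cong fermionicDegree s₁) (sym (length-thetas n₁)))) s₃)
            (sym (inversions-step i′ k≤i′ p₁ p₂ n₁ n₂ dots))))
      (factorizations-shape m n eqs)))
  (splits-dots p)
  where
  assemble : ∀ {k} i .(k≤i : k ≤ i) → Maybe Part → Maybe Part →
             Monomial (suc i) × Monomial (suc i) → Monomial k × Monomial k
  assemble i k≤i p₁ p₂ (m₁ , m₂) = optFactor i k≤i p₁ m₁ , optFactor i k≤i p₂ m₂

  inversions-step : ∀ {k} i .(k≤i : k ≤ i) p₁ p₂ m₁ m₂ →
    isDotted? p₁ ≡ false ⊎ isDotted? p₂ ≡ false →
    inversions (thetas (optFactor i k≤i p₁ m₁)) (thetas (optFactor i k≤i p₂ m₂)) ≡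
    (if isDotted? p₂ then length (thetas m₁) else 0) ℕ.+ inversions (thetas m₁) (thetas m₂)
  inversions-step i k≤i p₁ p₂ m₁ m₂ dots = trans
    (cong₂ inversions (thetas-optFactor i k≤i p₁ m₁) (thetas-optFactor i k≤i p₂ m₂))
    (inversions-cons (isDotted? p₁) (isDotted? p₂) i _ _ (thetas-above m₁) (thetas-above m₂) dots)

∑-zero : {A : Set} {F : A → ℚ} {xs : List A} → All (λ x → F x ≡ 0ℚ) xs → ∑ℚ (map F xs) ≡ 0ℚ
∑-zero []         = refl
∑-zero (eq ∷ eqs) = cong₂ ℚ._+_ eq (∑-zero eqs)

∑-pointwise : {A B : Set} {R : A → B → Set} {F : A → ℚ} {G : B → ℚ} {xs : List A} {ys : List B} →
  (∀ {x y} → R x y → F x ≡ G y) → Pointwise R xs ys → ∑ℚ (map F xs) ≡ ∑ℚ (map G ys)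
∑-pointwise h []       = refl
∑-pointwise h (r ∷ rs) = cong₂ ℚ._+_ (h r) (∑-pointwise h rs)

⋆-bounded : ∀ f g → HasBoundedDegree f → HasBoundedDegree g → HasBoundedDegree (f ⋆ g)
⋆-bounded f g (d , f≡0) (e , g≡0) = d ℕ.+ e , λ m d+e<m →
  ∑-zero (All.map (λ {(m₁ , m₂)} eq → vanish m₁ m₂ (subst (d ℕ.+ e <_) (sym eq) d+e<m))
                  (factorizations-degree m))
  where
  vanish : ∀ m₁ m₂ → d ℕ.+ e < degree m₁ ℕ.+ degree m₂ → signOf m₁ m₂ ℚ.* (f m₁ ℚ.* g m₂) ≡ 0ℚ
  vanish m₁ m₂ lt with d <? degree m₁ | e <? degree m₂
  ... | yes d< | _ = trans (cong (signOf m₁ m₂ ℚ.*_)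
        (trans (cong (ℚ._* g m₂) (f≡0 m₁ d<)) (ℚP.*-zeroˡ (g m₂)))) (ℚP.*-zeroʳ (signOf m₁ m₂))
  ... | no _ | yes e< = trans (cong (signOf m₁ m₂ ℚ.*_)
        (trans (cong (f m₁ ℚ.*_) (g≡0 m₂ e<)) (ℚP.*-zeroʳ (f m₁)))) (ℚP.*-zeroʳ (signOf m₁ m₂))
  ... | no d≮ | no e≮ =
    contradiction (ℕP.<-≤-trans lt (ℕP.+-mono-≤ (ℕP.≮⇒≥ d≮) (ℕP.≮⇒≥ e≮))) (ℕP.<-irrefl refl)

⋆-quasisymmetric : ∀ f g → IsQuasisymmetric f → IsQuasisymmetric g → IsQuasisymmetric (f ⋆ g)
⋆-quasisymmetric f g qf qg m m′ eq = ∑-pointwise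
  (λ {(m₁ , m₂)} {(n₁ , n₂)} (s₁ , s₂ , s₃) →
    cong₂ ℚ._*_ (cong ((ℚ.- 1ℚ) ^_) s₃) (cong₂ ℚ._*_ (qf m₁ n₁ s₁) (qg m₂ n₂ s₂)))
  (factorizations-shape m m′ eq)

-- The monomials of shape α, for the various i₁ < ⋯ < iₗ, are pairwise distinct, so
-- each has coefficient 1 in their sum.
M : DottedComposition → sQSym
M α = record
  { coeff          = λ m → if does (ListP.≡-dec _≟_ (shape m) α) then 1ℚ else 0ℚ
  ; bounded        = sum (map weight α) , vanish
  ; quasisymmetric = λ m m′ eq → cong (λ β → if does (ListP.≡-dec _≟_ β α) then 1ℚ else 0ℚ) eq
  }
  where
  vanish : ∀ m → sum (map weight α) < degree m →
           (if does (ListP.≡-dec _≟_ (shape m) α) then 1ℚ else 0ℚ) ≡ 0ℚ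
  vanish m lt with ListP.≡-dec _≟_ (shape m) α
  ... | yes eq = contradiction lt (ℕP.<-irrefl (cong (sum ∘ map weight) (sym eq)))
  ... | no _     = refl

infixl 6 _+_
infixl 7 _·_
infixr 7 _•_
infix  8 -_

0# : sQSym
0# = record
  { coeff = λ _ → 0ℚ ; bounded = 0 , λ _ _ → refl ; quasisymmetric = λ _ _ _ → refl }

_+_ : sQSym → sQSym → sQSym
f + g = record
  { coeff          = λ m → coeff f m ℚ.+ coeff g m
  ; bounded        = proj₁ (bounded f) ℕ.⊔ proj₁ (bounded g) , λ m lt → cong₂ ℚ._+_
      (proj₂ (bounded f) m (ℕP.≤-<-trans (ℕP.m≤m⊔n _ _) lt))
      (proj₂ (bounded g) m (ℕP.≤-<-trans (ℕP.m≤n⊔m (proj₁ (bounded f)) _) lt))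
  ; quasisymmetric = λ m m′ eq →
      cong₂ ℚ._+_ (quasisymmetric f m m′ eq) (quasisymmetric g m m′ eq)
  }

-_ : sQSym → sQSym
- f = record
  { coeff          = λ m → ℚ.- coeff f m
  ; bounded        = proj₁ (bounded f) , λ m lt → cong ℚ.-_ (proj₂ (bounded f) m lt)
  ; quasisymmetric = λ m m′ eq → cong ℚ.-_ (quasisymmetric f m m′ eq)
  }

_•_ : ℚ → sQSym → sQSym
c • f = record
  { coeff          = λ m → c ℚ.* coeff f m
  ; bounded        = proj₁ (bounded f) , λ m lt →
      trans (cong (c ℚ.*_) (proj₂ (bounded f) m lt)) (ℚP.*-zeroʳ c)
  ; quasisymmetric = λ m m′ eq → cong (c ℚ.*_) (quasisymmetric f m m′ eq)
  }

_·_ : sQSym → sQSym → sQSym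
f · g = record
  { coeff          = coeff f ⋆ coeff g
  ; bounded        = ⋆-bounded (coeff f) (coeff g) (bounded f) (bounded g)
  ; quasisymmetric =
      ⋆-quasisymmetric (coeff f) (coeff g) (quasisymmetric f) (quasisymmetric g)
  }

1# : sQSym
1# = M []

∑ : List sQSym → sQSym
∑ = foldr _+_ 0#

∑[_]_ : {P : DottedComposition → Set} → Enumeration P → (DottedComposition → sQSym) → sQSym
∑[ E ] F = ∑ (map F (Enumeration.elements E))

sQSym-leftModule : LeftModule ℚP.+-*-ring 0ℓ 0ℓ
sQSym-leftModule = record
  { Carrierᴹ = sQSym
  ; _≈ᴹ_ = _≈_
  ; _+ᴹ_ = _+_
  ; _*ₗ_ = _•_
  ; 0ᴹ   = 0#
  ; -ᴹ_  = -_
  ; isLeftModule = record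
    { isLeftSemimodule = record
      { +ᴹ-isCommutativeMonoid = record
        { isMonoid = record
          { isSemigroup = record
            { isMagma = record
              { isEquivalence = record
                { refl  = λ _ → refl
                ; sym   = λ p m → sym (p m)
                ; trans = λ p q m → trans (p m) (q m)
                }
              ; ∙-cong = λ p q m → cong₂ ℚ._+_ (p m) (q m)
              }
            ; assoc = λ f g h m → ℚP.+-assoc (coeff f m) (coeff g m) (coeff h m)
            }
          ; identity = (λ f m → ℚP.+-identityˡ (coeff f m)) , (λ f m → ℚP.+-identityʳ (coeff f m))
          }
        ; comm = λ f g m → ℚP.+-comm (coeff f m) (coeff g m)
        }
      ; isPreleftSemimodule = record
        { *ₗ-cong      = λ { {c} refl p m → cong (c ℚ.*_) (p m) }
        ; *ₗ-zeroˡ     = λ f m → ℚP.*-zeroˡ (coeff f m)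
        ; *ₗ-distribʳ  = λ f c d m → ℚP.*-distribʳ-+ (coeff f m) c d
        ; *ₗ-identityˡ = λ f m → ℚP.*-identityˡ (coeff f m)
        ; *ₗ-assoc     = λ c d f m → ℚP.*-assoc c d (coeff f m)
        ; *ₗ-zeroʳ     = λ c m → ℚP.*-zeroʳ c
        ; *ₗ-distribˡ  = λ c f g m → ℚP.*-distribˡ-+ c (coeff f m) (coeff g m)
        }
      }
    ; -ᴹ‿cong    = λ p m → cong ℚ.-_ (p m)
    ; -ᴹ‿inverse = (λ f m → ℚP.+-inverseˡ (coeff f m)) , (λ f m → ℚP.+-inverseʳ (coeff f m))
    }
  }

IsLinear : (sQSym → sQSym) → Set
IsLinear = IsLeftModuleHomomorphism
  where
  open ModuleMorphisms.LeftModuleMorphisms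
    (LeftModule.rawLeftModule sQSym-leftModule) (LeftModule.rawLeftModule sQSym-leftModule)

-- A formal sum Σⱼ fⱼ ⊗ gⱼ.  Two such sums are the same tensor when they have the
-- same image under ⟦_⟧.
Tensor : Set
Tensor = List (sQSym × sQSym)

-- Power series in (x; θ) and (y; φ): the value at (m₁ , m₂) is the coefficient of
-- the product m₁(x; θ) m₂(y; φ), in which all θ's stand to the left of all φ's and
-- which is therefore already written in the order of the union of the alphabets.
BiSeries : Set
BiSeries = Monomial 1 → Monomial 1 → ℚ

-- Σⱼ fⱼ(x; θ) gⱼ(y; φ); no sign arises, because the θ's precede the φ's.
⟦_⟧ : Tensor → BiSeries
⟦ t ⟧ m₁ m₂ = ∑ℚ (map (λ (f , g) → coeff f m₁ ℚ.* coeff g m₂) t)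

-- f(x, y; θ, φ): in the ordered union of the two alphabets the monomial
-- m₁(x; θ) m₂(y; φ) has shape m₁ followed by shape m₂, so its coefficient is that
-- of any monomial of this shape in f.
onUnion : sQSym → BiSeries
onUnion f m₁ m₂ = coeff f (consecutive 1 (shape m₁ ++ shape m₂))

-- t, read as an element of sQSym ⊗ sQSym, is Δ f.
_IsΔ_ : Tensor → sQSym → Set
t IsΔ f = ∀ m₁ m₂ → ⟦ t ⟧ m₁ m₂ ≡ onUnion f m₁ m₂

_⊗_ : (sQSym → sQSym) → (sQSym → sQSym) → Tensor → Tensor
F ⊗ G = map (Product.map F G)

mult : Tensor → sQSym
mult t = ∑ (map (λ (f , g) → f · g) t)

unit : ℚ → sQSym
unit c = c • 1#

-- The constant coefficient, i.e. the linear map with the two values below.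
counit : sQSym → ℚ
counit f = coeff f one

counit-1 : counit 1# ≡ 1ℚ
counit-1 = refl

counit-M : ∀ α → α ≢ [] → counit (M α) ≡ 0ℚ
counit-M []      α≢[] = contradiction refl α≢[]
counit-M (_ ∷ _) _    = refl

-- left and right hold for every way t of writing Δ f as a sum of pure tensors.
record IsAntipode (S : sQSym → sQSym) : Set where
  field
    linear : IsLinear S
    left   : ∀ f t → t IsΔ f → mult ((S ⊗ id) t) ≈ unit (counit f)
    right  : ∀ f t → t IsΔ f → mult ((id ⊗ S) t) ≈ unit (counit f)

{-# OPTIONS --safe #-}

-- ΔM_α is the sum of M_β ⊗ M_γ over the cuts α = βγ, so by induction on the length it
-- suffices that Σ ± C(rev β) M_γ = 0 over the cuts of a nonempty α, where C(δ) is the sum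
-- of the M's above δ.  Compare the coefficients of a monomial with leading factor p in
-- the variables of smallest index i.  In C(rev β) M_γ these variables come from C(rev β)
-- alone, or else also from the first part g of γ; since p is then a sum of g and (possibly
-- no) last parts of β, the second contribution is, up to sign, the first one for the
-- next cut, with g moved from γ to β.  Hence the alternating sum telescopes to the first
-- contribution for β = ∅, which is 0.  Moving the θ of g past those left in C(rev β)
-- costs (-1)^(m_β), and these signs accumulate to the binomial coefficient.
module Submission where

open import Defs
open import Algebra.Bundles using (CommutativeRing)
import Algebra.Properties.Group as GroupProperties
import Algebra.Properties.Semiring.Exp as Exp
open import Data.Bool using (true; false; _∧_; if_then_else_)
open import Data.List
  using (List; []; _∷_; _++_; map; length; reverse; concatMap; mapMaybe; _ʳ++_)
import Data.List.Properties as ListP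
open import Data.List.Properties using (map-∘; map-cong; map-cong-local)
open import Data.List.Relation.Binary.Permutation.Propositional.Properties
  using (filter-↭; ↭-length; ↭-reverse)
open import Data.List.Relation.Unary.All as All using (All; []; _∷_)
open import Data.Maybe as Maybe using (Maybe; just; nothing; maybe′)
import Data.Maybe.Properties as MaybeP
open import Data.Nat as ℕ using (ℕ; zero; suc; _≤_; _<_; s≤s; z≤n; _∸_)
open import Data.Nat.Combinatorics using (_C_; nC1≡n; nCk+nC[k+1]≡[n+1]C[k+1])
import Data.Nat.Properties as ℕP
open import Data.Product as Product using (_×_; _,_)
open import Data.Rational as ℚ using (ℚ; 0ℚ; 1ℚ)
import Data.Rational.Properties as ℚP
open import Data.Rational.Solver using (module +-*-Solver)
open import Data.Sum as Sum using (_⊎_; inj₁; inj₂)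
open import Function using (_∘_; id)
open import Relation.Binary.PropositionalEquality
open import Relation.Nullary using (Dec; yes; no; does; contradiction)
open import Relation.Nullary.Decidable using (dec-true; dec-false)

open ≡-Reasoning
private module ℚ+ = GroupProperties ℚP.+-0-group

-- Finite sums of rationals.

sumOver : {A : Set} → (A → ℚ) → List A → ℚ
sumOver F xs = ∑ℚ (map F xs)

module _ {A : Set} where

  sumOver-cong : {F G : A → ℚ} → (∀ x → F x ≡ G x) → ∀ xs → sumOver F xs ≡ sumOver G xs
  sumOver-cong eq xs = cong ∑ℚ (map-cong eq xs)

  sumOver-zero : {F : A → ℚ} → (∀ x → F x ≡ 0ℚ) → ∀ xs → sumOver F xs ≡ 0ℚ
  sumOver-zero eq xs = ∑-zero (All.universal eq xs)

  sumOver-++ : (F : A → ℚ) → ∀ xs ys → sumOver F (xs ++ ys) ≡ sumOver F xs ℚ.+ sumOver F ys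
  sumOver-++ F []       ys = sym (ℚP.+-identityˡ _)
  sumOver-++ F (x ∷ xs) ys =
    trans (cong (F x ℚ.+_) (sumOver-++ F xs ys)) (sym (ℚP.+-assoc (F x) _ _))

  sumOver-+ : (F G : A → ℚ) → ∀ xs →
              sumOver (λ x → F x ℚ.+ G x) xs ≡ sumOver F xs ℚ.+ sumOver G xs
  sumOver-+ F G []       = refl
  sumOver-+ F G (x ∷ xs) = trans (cong ((F x ℚ.+ G x) ℚ.+_) (sumOver-+ F G xs))
    (solve 4 (λ a b c d → (a :+ b) :+ (c :+ d) := (a :+ c) :+ (b :+ d)) refl
      (F x) (G x) (sumOver F xs) (sumOver G xs))
    where open +-*-Solver

  sumOver-*ˡ : ∀ c (F : A → ℚ) xs → sumOver (λ x → c ℚ.* F x) xs ≡ c ℚ.* sumOver F xs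
  sumOver-*ˡ c F []       = sym (ℚP.*-zeroʳ c)
  sumOver-*ˡ c F (x ∷ xs) =
    trans (cong (c ℚ.* F x ℚ.+_) (sumOver-*ˡ c F xs)) (sym (ℚP.*-distribˡ-+ c (F x) _))

  sumOver-map : {B : Set} (F : A → ℚ) (h : B → A) → ∀ xs → sumOver F (map h xs) ≡ sumOver (F ∘ h) xs
  sumOver-map F h xs = cong ∑ℚ (sym (map-∘ xs))

  sumOver-concatMap : {B : Set} (F : A → ℚ) (h : B → List A) → ∀ xs →
                      sumOver F (concatMap h xs) ≡ sumOver (λ x → sumOver F (h x)) xs
  sumOver-concatMap F h []       = refl
  sumOver-concatMap F h (x ∷ xs) =
    trans (sumOver-++ F (h x) (concatMap h xs)) (cong (sumOver F (h x) ℚ.+_) (sumOver-concatMap F h xs))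

  sumOver-mapMaybe : {B : Set} (F : A → ℚ) (h : B → Maybe A) → ∀ xs →
                     sumOver F (mapMaybe h xs) ≡ sumOver (maybe′ F 0ℚ ∘ h) xs
  sumOver-mapMaybe F h []       = refl
  sumOver-mapMaybe F h (x ∷ xs) with h x
  ... | just y  = cong (F y ℚ.+_) (sumOver-mapMaybe F h xs)
  ... | nothing = trans (sumOver-mapMaybe F h xs) (sym (ℚP.+-identityˡ _))

-- Signs and indicator functions of compositions.

-1^_ : ℕ → ℚ
-1^ n = (ℚ.- 1ℚ) ^ n

-1^-+ : ∀ m n → -1^ (m ℕ.+ n) ≡ -1^ m ℚ.* -1^ n
-1^-+ = Exp.^-homo-* (CommutativeRing.semiring ℚP.+-*-commutativeRing) (ℚ.- 1ℚ)

infix 4 _≟ᶜ_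
_≟ᶜ_ = ListP.≡-dec _≟_

𝟙 : DottedComposition → DottedComposition → ℚ
𝟙 γ δ = if does (γ ≟ᶜ δ) then 1ℚ else 0ℚ

𝟙-≢ : ∀ {γ δ} → γ ≢ δ → 𝟙 γ δ ≡ 0ℚ
𝟙-≢ {γ} {δ} ne = cong (λ b → if b then 1ℚ else 0ℚ) (dec-false (γ ≟ᶜ δ) ne)

𝟙-∷ : ∀ p γ δ → 𝟙 (p ∷ γ) (p ∷ δ) ≡ 𝟙 γ δ
𝟙-∷ p γ δ = cong (λ b → if b ∧ does (γ ≟ᶜ δ) then 1ℚ else 0ℚ) (dec-true (p ≟ p) refl)

𝟙-∷-≢ : ∀ {p q} γ δ → p ≢ q → 𝟙 (p ∷ γ) (q ∷ δ) ≡ 0ℚ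
𝟙-∷-≢ {p} {q} γ δ ne = 𝟙-≢ {p ∷ γ} {q ∷ δ} (ne ∘ ListP.∷-injectiveˡ)

infixr 5 _∷?_
_∷?_ : Maybe Part → DottedComposition → DottedComposition
p ∷? γ = maybe′ _∷_ id p γ

-- Products computed on coefficient functions.

-- A coefficient function on dotted compositions stands for the quasisymmetric series
-- with these coefficients; convolve m f g is the coefficient of m in the product.
Coefficients : Set
Coefficients = DottedComposition → ℚ

convolve : ∀ {k} → Monomial k → Coefficients → Coefficients → ℚ
convolve m f g =
  sumOver (λ (m₁ , m₂) → signOf m₁ m₂ ℚ.* (f (shape m₁) ℚ.* g (shape m₂))) (factorizations m)

module _ {k} (m : Monomial k) where

  convolve-congˡ : ∀ {f f′} g → (∀ γ → f γ ≡ f′ γ) → convolve m f g ≡ convolve m f′ g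
  convolve-congˡ g eq = sumOver-cong
    (λ (m₁ , m₂) → cong (λ c → signOf m₁ m₂ ℚ.* (c ℚ.* g (shape m₂))) (eq (shape m₁)))
    (factorizations m)

  convolve-congʳ : ∀ f {g g′} → (∀ γ → g γ ≡ g′ γ) → convolve m f g ≡ convolve m f g′
  convolve-congʳ f eq = sumOver-cong
    (λ (m₁ , m₂) → cong (λ c → signOf m₁ m₂ ℚ.* (f (shape m₁) ℚ.* c)) (eq (shape m₂)))
    (factorizations m)

  convolve-zeroˡ : ∀ f g → (∀ γ → f γ ≡ 0ℚ) → convolve m f g ≡ 0ℚ
  convolve-zeroˡ f g eq = sumOver-zero
    (λ (m₁ , m₂) → trans (cong (λ c → signOf m₁ m₂ ℚ.* (c ℚ.* g (shape m₂))) (eq (shape m₁)))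
      (trans (cong (signOf m₁ m₂ ℚ.*_) (ℚP.*-zeroˡ (g (shape m₂)))) (ℚP.*-zeroʳ (signOf m₁ m₂))))
    (factorizations m)

  convolve-zeroʳ : ∀ f g → (∀ γ → g γ ≡ 0ℚ) → convolve m f g ≡ 0ℚ
  convolve-zeroʳ f g eq = sumOver-zero
    (λ (m₁ , m₂) → trans (cong (λ c → signOf m₁ m₂ ℚ.* (f (shape m₁) ℚ.* c)) (eq (shape m₂)))
      (trans (cong (signOf m₁ m₂ ℚ.*_) (ℚP.*-zeroʳ (f (shape m₁)))) (ℚP.*-zeroʳ (signOf m₁ m₂))))
    (factorizations m)

  convolve-*ˡ : ∀ c f g → convolve m (λ γ → c ℚ.* f γ) g ≡ c ℚ.* convolve m f g
  convolve-*ˡ c f g = trans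
    (sumOver-cong (λ (m₁ , m₂) →
      solve 4 (λ s c x y → s :* ((c :* x) :* y) := c :* (s :* (x :* y))) refl
        (signOf m₁ m₂) c (f (shape m₁)) (g (shape m₂))) (factorizations m))
    (sumOver-*ˡ c _ (factorizations m))
    where open +-*-Solver

convolve-one : ∀ {k} f g → convolve (one {k}) f g ≡ f [] ℚ.* g []
convolve-one f g = trans (ℚP.+-identityʳ _) (ℚP.*-identityˡ _)

dots? : Maybe Part → ℕ → ℕ
dots? p n = if isDotted? p then n else 0

-- The sign of moving the θ of a part p of the right factor to the left, past the
-- remaining θ's of the left factor.
twist : Maybe Part → Coefficients → Coefficients
twist p f γ = -1^ dots? p (fermionicDegree γ) ℚ.* f γ

-- Distributing θᵢ and xᵢ first leaves a product at `m`. As `i` is below every index of `m`, a θᵢ in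
-- the left factor passes nothing, while one in the right factor passes exactly the θ's of `m₁`,
-- which gives `twist`.
convolve-factor : ∀ {k} i .(k≤i : k ≤ i) p m f g →
  convolve (factor i k≤i p m) f g ≡
  sumOver (λ (p₁ , p₂) → convolve m (twist p₂ (f ∘ (p₁ ∷?_))) (g ∘ (p₂ ∷?_))) (splits p)
convolve-factor i k≤i p m f g = trans
  (sumOver-concatMap _ _ (splits p))
  (cong ∑ℚ (map-cong-local (All.map
    (λ {(p₁ , p₂)} dots → trans (sumOver-map _ _ (factorizations m))
      (sumOver-cong (λ (m₁ , m₂) → term p₁ p₂ m₁ m₂ dots) (factorizations m)))
    (splits-dots p))))
  where
  open +-*-Solver
  term : ∀ p₁ p₂ m₁ m₂ → isDotted? p₁ ≡ false ⊎ isDotted? p₂ ≡ false →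
    signOf (optFactor i k≤i p₁ m₁) (optFactor i k≤i p₂ m₂) ℚ.*
      (f (shape (optFactor i k≤i p₁ m₁)) ℚ.* g (shape (optFactor i k≤i p₂ m₂)))
    ≡ signOf m₁ m₂ ℚ.* (twist p₂ (f ∘ (p₁ ∷?_)) (shape m₁) ℚ.* g (p₂ ∷? shape m₂))
  term p₁ p₂ m₁ m₂ dots = begin
    _ ≡⟨ cong₂ ℚ._*_ sign (cong₂ (λ γ δ → f γ ℚ.* g δ)
           (shape-optFactor i k≤i p₁ m₁) (shape-optFactor i k≤i p₂ m₂)) ⟩
    (-1^ dots? p₂ (fermionicDegree (shape m₁)) ℚ.* signOf m₁ m₂) ℚ.*
      (f (p₁ ∷? shape m₁) ℚ.* g (p₂ ∷? shape m₂))
      ≡⟨ solve 4 (λ t s x y → (t :* s) :* (x :* y) := s :* ((t :* x) :* y)) refl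
           (-1^ dots? p₂ (fermionicDegree (shape m₁))) (signOf m₁ m₂)
           (f (p₁ ∷? shape m₁)) (g (p₂ ∷? shape m₂)) ⟩
    _ ∎
    where
    sign : signOf (optFactor i k≤i p₁ m₁) (optFactor i k≤i p₂ m₂) ≡
           -1^ dots? p₂ (fermionicDegree (shape m₁)) ℚ.* signOf m₁ m₂
    sign = trans
      (cong -1^_ (trans
        (cong₂ inversions (thetas-optFactor i k≤i p₁ m₁) (thetas-optFactor i k≤i p₂ m₂))
        (trans (inversions-cons (isDotted? p₁) (isDotted? p₂) i _ _
                 (thetas-above m₁) (thetas-above m₂) dots)
               (cong (λ l → dots? p₂ l ℕ.+ inversions (thetas m₁) (thetas m₂)) (length-thetas m₁)))))
      (-1^-+ (dots? p₂ (fermionicDegree (shape m₁))) _)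

-- Distributing a single part over two factors.

subtract : ℕ → ℕ → Maybe ℕ
subtract a       zero    = just a
subtract zero    (suc c) = nothing
subtract (suc a) (suc c) = subtract a c

antidiagonal-suc : ∀ a → antidiagonal (suc a) ≡ (0 , suc a) ∷ map (Product.map₁ suc) (antidiagonal a)
antidiagonal-suc a = cong ((0 , suc a) ∷_) (sym (ListP.map-applyUpTo (λ b → b , a ∸ b) (Product.map₁ suc) (suc a)))

-- The list unfolds by its first coordinate; splitting off the last pair instead allows recursion on
-- the second.
antidiagonal-last : ∀ (ψ : ℕ × ℕ → ℚ) a →
  sumOver ψ (antidiagonal (suc a)) ≡ sumOver (ψ ∘ Product.map₂ suc) (antidiagonal a) ℚ.+ ψ (suc a , 0)
antidiagonal-last ψ zero    =
  solve 2 (λ x y → x :+ (y :+ con 0ℚ) := (x :+ con 0ℚ) :+ y) refl (ψ (0 , 1)) (ψ (1 , 0))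
  where open +-*-Solver
antidiagonal-last ψ (suc a) = begin
  sumOver ψ (antidiagonal (suc (suc a)))
    ≡⟨ first ψ (suc a) ⟩
  ψ (0 , suc (suc a)) ℚ.+ sumOver (ψ ∘ Product.map₁ suc) (antidiagonal (suc a))
    ≡⟨ cong (ψ (0 , suc (suc a)) ℚ.+_) (antidiagonal-last (ψ ∘ Product.map₁ suc) a) ⟩
  ψ (0 , suc (suc a)) ℚ.+ (sumOver (ψ ∘ Product.map suc suc) (antidiagonal a) ℚ.+ ψ (suc (suc a) , 0))
    ≡⟨ sym (ℚP.+-assoc (ψ (0 , suc (suc a))) _ _) ⟩
  (ψ (0 , suc (suc a)) ℚ.+ sumOver (ψ ∘ Product.map suc suc) (antidiagonal a)) ℚ.+ ψ (suc (suc a) , 0)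
    ≡⟨ cong (ℚ._+ ψ (suc (suc a) , 0)) (sym (first (ψ ∘ Product.map₂ suc) a)) ⟩
  sumOver (ψ ∘ Product.map₂ suc) (antidiagonal (suc a)) ℚ.+ ψ (suc (suc a) , 0) ∎
  where
  first : ∀ (ψ : ℕ × ℕ → ℚ) a → sumOver ψ (antidiagonal (suc a)) ≡
          ψ (0 , suc a) ℚ.+ sumOver (ψ ∘ Product.map₁ suc) (antidiagonal a)
  first ψ a = trans (cong (sumOver ψ) (antidiagonal-suc a))
                    (cong (ψ (0 , suc a) ℚ.+_) (sumOver-map ψ _ (antidiagonal a)))

antidiagonal-select : ∀ (ψ : ℕ × ℕ → ℚ) a c → (∀ x y → y ≢ c → ψ (x , y) ≡ 0ℚ) →
  sumOver ψ (antidiagonal a) ≡ maybe′ (λ x → ψ (x , c)) 0ℚ (subtract a c)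
antidiagonal-select ψ zero    zero    vanish = ℚP.+-identityʳ _
antidiagonal-select ψ zero    (suc c) vanish = trans (ℚP.+-identityʳ _) (vanish 0 0 λ ())
antidiagonal-select ψ (suc a) zero    vanish = trans (antidiagonal-last ψ a)
  (trans (cong (ℚ._+ ψ (suc a , 0)) (sumOver-zero (λ (x , y) → vanish x (suc y) λ ()) (antidiagonal a)))
         (ℚP.+-identityˡ _))
antidiagonal-select ψ (suc a) (suc c) vanish = trans (antidiagonal-last ψ a)
  (trans (cong₂ ℚ._+_
           (antidiagonal-select (ψ ∘ Product.map₂ suc) a c
             (λ x y ne → vanish x (suc y) (ne ∘ ℕP.suc-injective)))
           (vanish (suc a) 0 λ ()))
         (ℚP.+-identityʳ _))

-- Two second coordinates may survive: `suc c`, and 0, for which `plain?` yields no part at all.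
antidiagonal-select₂ : ∀ (ψ : ℕ × ℕ → ℚ) a c → (∀ x y → y ≢ c → ψ (x , suc y) ≡ 0ℚ) →
  sumOver ψ (antidiagonal a) ≡ ψ (a , 0) ℚ.+ maybe′ (λ x → ψ (x , suc c)) 0ℚ (subtract a (suc c))
antidiagonal-select₂ ψ zero    c vanish = refl
antidiagonal-select₂ ψ (suc a) c vanish = trans (antidiagonal-last ψ a)
  (trans (ℚP.+-comm _ (ψ (suc a , 0)))
         (cong (ψ (suc a , 0) ℚ.+_) (antidiagonal-select (ψ ∘ Product.map₂ suc) a c vanish)))

-- q ⊖ s is the part r with s ⊕ r = q, where r = nothing stands for the empty part.
infix 6 _⊖_
_⊖_ : Part → Part → Maybe (Maybe Part)
plain a  ⊖ plain b  = Maybe.map plain? (subtract a b)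
plain _  ⊖ dotted _ = nothing
dotted a ⊖ plain b  = Maybe.map (just ∘ dotted) (subtract a b)
dotted a ⊖ dotted b = Maybe.map plain? (subtract a b)

data Difference (q s : Part) : Maybe (Maybe Part) → Set where
  equal : q ≡ s → Difference q s (just nothing)
  rest  : ∀ r → s ⊕ r ≡ just q → Difference q s (just (just r))
  none  : q ≢ s → (∀ r → s ⊕ r ≢ just q) → Difference q s nothing

data Subtraction (a b : ℕ) : Maybe ℕ → Set where
  by      : ∀ c → a ≡ b ℕ.+ c → Subtraction a b (just c)
  smaller : a < b → Subtraction a b nothing

subtraction : ∀ a b → Subtraction a b (subtract a b)
subtraction a       zero    = by a refl
subtraction zero    (suc b) = smaller (s≤s z≤n)
subtraction (suc a) (suc b) with subtract a b | subtraction a b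
... | _ | by c eq    = by c (cong suc eq)
... | _ | smaller lt = smaller (s≤s lt)

difference : ∀ q s → Difference q s (q ⊖ s)
difference (plain a) (plain b) with subtract a b | subtraction a b
... | _ | by zero eq    = equal (plain-cong (trans eq (ℕP.+-identityʳ b)))
... | _ | by (suc c) eq = rest (plain (suc c)) (cong just (plain-cong (sym eq)))
... | _ | smaller a<b   = none (λ eq → ℕP.<⇒≢ a<b (plain-inj eq)) λ
  { (plain c) eq → ℕP.<⇒≱ a<b
      (subst (b ≤_) (plain-inj (MaybeP.just-injective eq)) (ℕP.m≤m+n b c))
  ; (dotted c) () }
difference (plain a) (dotted b) = none (λ ()) λ { (plain c) () ; (dotted c) () }
difference (dotted a) (plain b) with subtract a b | subtraction a b
-- Even `c = 0` leaves a genuine part, `dotted 0`, so the remainder is never empty.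
... | _ | by c eq     = rest (dotted c) (cong (just ∘ dotted) (sym eq))
... | _ | smaller a<b = none (λ ()) λ
  { (plain c) ()
  ; (dotted c) eq → ℕP.<⇒≱ a<b
      (subst (b ≤_) (dotted-inj (MaybeP.just-injective eq)) (ℕP.m≤m+n b c)) }
difference (dotted a) (dotted b) with subtract a b | subtraction a b
... | _ | by zero eq    = equal (cong dotted (trans eq (ℕP.+-identityʳ b)))
... | _ | by (suc c) eq = rest (plain (suc c)) (cong (just ∘ dotted) (sym eq))
... | _ | smaller a<b   = none (λ eq → ℕP.<⇒≢ a<b (dotted-inj eq)) λ
  { (plain c) eq → ℕP.<⇒≱ a<b
      (subst (b ≤_) (dotted-inj (MaybeP.just-injective eq)) (ℕP.m≤m+n b c))
  ; (dotted c) () }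

module _ (Φ : Maybe Part × Maybe Part → ℚ) where

  private
    pp dp pd : ℕ × ℕ → ℚ
    pp (x , y) = Φ (plain? x , plain? y)
    dp (x , y) = Φ (just (dotted x) , plain? y)
    pd (x , y) = Φ (plain? x , just (dotted y))

    sum-plain : ∀ a .⦃ _ : ℕ.NonZero a ⦄ → sumOver Φ (splits (plain a)) ≡ sumOver pp (antidiagonal a)
    sum-plain a = sumOver-map Φ (λ (b , c) → plain? b , plain? c) (antidiagonal a)

    sum-dotted : ∀ a → sumOver Φ (splits (dotted a)) ≡
                 sumOver dp (antidiagonal a) ℚ.+ sumOver pd (antidiagonal a)
    sum-dotted a = trans
      (sumOver-++ Φ (map (λ (b , c) → just (dotted b) , plain? c) (antidiagonal a)) _)
      (cong₂ ℚ._+_ (sumOver-map Φ (λ (b , c) → just (dotted b) , plain? c) (antidiagonal a))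
                   (sumOver-map Φ (λ (b , c) → plain? b , just (dotted c)) (antidiagonal a)))

  -- If the right factor may receive only `g` or nothing, then the left one receives `p ⊖ g` or all
  -- of `p`: at most two splits survive.
  splits-select : ∀ p g → (∀ p₁ q → q ≢ g → Φ (p₁ , just q) ≡ 0ℚ) →
    sumOver Φ (splits p) ≡ Φ (just p , nothing) ℚ.+ maybe′ (λ r → Φ (r , just g)) 0ℚ (p ⊖ g)
  splits-select (plain a@(suc _)) g@(plain c@(suc b)) vanish = begin
    sumOver Φ (splits (plain a))  ≡⟨ sum-plain a ⟩
    sumOver pp (antidiagonal a)   ≡⟨ antidiagonal-select₂ pp a b
      (λ x y ne → vanish (plain? x) (plain (suc y)) (ne ∘ ℕP.suc-injective ∘ plain-inj)) ⟩
    pp (a , 0) ℚ.+ maybe′ (λ x → pp (x , c)) 0ℚ (subtract a c)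
      ≡⟨ cong (pp (a , 0) ℚ.+_) (sym (MaybeP.maybe′-map (λ r → Φ (r , just g)) 0ℚ plain? (subtract a c))) ⟩
    pp (a , 0) ℚ.+ maybe′ (λ r → Φ (r , just g)) 0ℚ (plain a ⊖ g) ∎
  splits-select (plain a@(suc _)) (dotted b) vanish = begin
    sumOver Φ (splits (plain a))  ≡⟨ sum-plain a ⟩
    -- A plain part cannot give up a dotted one, so only the exponent 0 on the right survives;
    -- `plain a ⊖ dotted b` supplies the zero summand.
    sumOver pp (antidiagonal a)   ≡⟨ antidiagonal-select pp a 0
      (λ { x zero ne → contradiction refl ne ; x (suc y) _ → vanish (plain? x) (plain (suc y)) λ () }) ⟩
    pp (a , 0)                    ≡⟨ sym (ℚP.+-identityʳ _) ⟩
    pp (a , 0) ℚ.+ 0ℚ             ∎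
  splits-select (dotted a) g@(plain c@(suc b)) vanish = begin
    sumOver Φ (splits (dotted a))  ≡⟨ sum-dotted a ⟩
    sumOver dp (antidiagonal a) ℚ.+ sumOver pd (antidiagonal a)
      ≡⟨ cong (sumOver dp (antidiagonal a) ℚ.+_)
           (sumOver-zero (λ (x , y) → vanish (plain? x) (dotted y) λ ()) (antidiagonal a)) ⟩
    sumOver dp (antidiagonal a) ℚ.+ 0ℚ  ≡⟨ ℚP.+-identityʳ _ ⟩
    sumOver dp (antidiagonal a)         ≡⟨ antidiagonal-select₂ dp a b
      (λ x y ne → vanish (just (dotted x)) (plain (suc y)) (ne ∘ ℕP.suc-injective ∘ plain-inj)) ⟩
    dp (a , 0) ℚ.+ maybe′ (λ x → dp (x , c)) 0ℚ (subtract a c)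
      ≡⟨ cong (dp (a , 0) ℚ.+_)
           (sym (MaybeP.maybe′-map (λ r → Φ (r , just g)) 0ℚ (just ∘ dotted) (subtract a c))) ⟩
    dp (a , 0) ℚ.+ maybe′ (λ r → Φ (r , just g)) 0ℚ (dotted a ⊖ g) ∎
  splits-select (dotted a) g@(dotted b) vanish = begin
    sumOver Φ (splits (dotted a))  ≡⟨ sum-dotted a ⟩
    sumOver dp (antidiagonal a) ℚ.+ sumOver pd (antidiagonal a)
      -- If θ goes left, the right part is plain, hence absent; if θ goes right, the right part must
      -- be `g`. Each sum keeps at most one term.
      ≡⟨ cong₂ ℚ._+_
           (antidiagonal-select dp a 0 (λ { x zero ne → contradiction refl ne
              ; x (suc y) _ → vanish (just (dotted x)) (plain (suc y)) λ () }))
           (antidiagonal-select pd a b (λ x y ne → vanish (plain? x) (dotted y) (ne ∘ dotted-inj))) ⟩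
    dp (a , 0) ℚ.+ maybe′ (λ x → pd (x , b)) 0ℚ (subtract a b)
      ≡⟨ cong (dp (a , 0) ℚ.+_) (sym (MaybeP.maybe′-map (λ r → Φ (r , just g)) 0ℚ plain? (subtract a b))) ⟩
    dp (a , 0) ℚ.+ maybe′ (λ r → Φ (r , just g)) 0ℚ (dotted a ⊖ g) ∎

-- Products with a basis element on the right.

indicator : DottedComposition → Coefficients
indicator γ δ = 𝟙 δ γ

private
  untwist : ∀ f γ → twist nothing f γ ≡ f γ
  untwist f γ = ℚP.*-identityˡ (f γ)

  maybe′-cong : {F G : Maybe Part → ℚ} → (∀ r → F r ≡ G r) → ∀ r → maybe′ F 0ℚ r ≡ maybe′ G 0ℚ r
  maybe′-cong eq (just r) = eq r
  maybe′-cong eq nothing  = refl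

  maybe′-zero : {F : Maybe Part → ℚ} → (∀ r → F r ≡ 0ℚ) → ∀ r → maybe′ F 0ℚ r ≡ 0ℚ
  maybe′-zero eq (just r) = eq r
  maybe′-zero eq nothing  = refl

convolve-factor-select : ∀ {k} i .(k≤i : k ≤ i) p m f h g → (∀ q δ → q ≢ g → h (q ∷ δ) ≡ 0ℚ) →
  convolve (factor i k≤i p m) f h ≡
  convolve m (f ∘ (p ∷_)) h ℚ.+
  maybe′ (λ r → convolve m (twist (just g) (f ∘ (r ∷?_))) (h ∘ (g ∷_))) 0ℚ (p ⊖ g)
convolve-factor-select i k≤i p m f h g vanish = begin
  _ ≡⟨ convolve-factor i k≤i p m f h ⟩
  _ ≡⟨ splits-select (λ (p₁ , p₂) → convolve m (twist p₂ (f ∘ (p₁ ∷?_))) (h ∘ (p₂ ∷?_))) p g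
         (λ p₁ q ne → convolve-zeroʳ m (twist (just q) (f ∘ (p₁ ∷?_))) (h ∘ (q ∷_))
           (λ δ → vanish q δ ne)) ⟩
  _ ≡⟨ cong (ℚ._+ maybe′ (λ r → convolve m (twist (just g) (f ∘ (r ∷?_))) (h ∘ (g ∷_))) 0ℚ (p ⊖ g))
         (convolve-congˡ m h (untwist (f ∘ (p ∷_)))) ⟩
  _ ∎

convolve-factor-∷ : ∀ {k} i .(k≤i : k ≤ i) p m f g γ →
  convolve (factor i k≤i p m) f (indicator (g ∷ γ)) ≡
  convolve m (f ∘ (p ∷_)) (indicator (g ∷ γ)) ℚ.+
  maybe′ (λ r → convolve m (twist (just g) (f ∘ (r ∷?_))) (indicator γ)) 0ℚ (p ⊖ g)
convolve-factor-∷ i k≤i p m f g γ = trans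
  (convolve-factor-select i k≤i p m f (indicator (g ∷ γ)) g (λ q δ → 𝟙-∷-≢ δ γ))
  (cong (convolve m (f ∘ (p ∷_)) (indicator (g ∷ γ)) ℚ.+_)
    (maybe′-cong (λ r → convolve-congʳ m (twist (just g) (f ∘ (r ∷?_))) (λ δ → 𝟙-∷ g δ γ)) (p ⊖ g)))

convolve-factor-[] : ∀ {k} i .(k≤i : k ≤ i) p m f →
  convolve (factor i k≤i p m) f (indicator []) ≡ convolve m (f ∘ (p ∷_)) (indicator [])
convolve-factor-[] i k≤i p m f = trans
  -- Any part can stand for `g` here, because `indicator []` vanishes on all nonempty compositions;
  -- `p` is at hand.
  (convolve-factor-select i k≤i p m f (indicator []) p (λ _ _ _ → refl))
  (trans (cong (convolve m (f ∘ (p ∷_)) (indicator []) ℚ.+_)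
           (maybe′-zero (λ r → convolve-zeroʳ m (twist (just p) (f ∘ (r ∷?_))) (indicator [] ∘ (p ∷_))
             (λ _ → refl)) (p ⊖ p)))
         (ℚP.+-identityʳ _))

convolve-identityʳ : ∀ {k} (m : Monomial k) f → convolve m f (indicator []) ≡ f (shape m)
convolve-identityʳ {k} one f = trans (convolve-one {k} f (indicator [])) (ℚP.*-identityʳ (f []))
convolve-identityʳ (factor i k≤i p m) f =
  trans (convolve-factor-[] i k≤i p m f) (convolve-identityʳ m (f ∘ (p ∷_)))

-- Coefficients of the sum over coarsenings.

-- The coefficient function of the series C(β). Counting occurrences in the list lets the recursion
-- of `coarsenings` turn directly into one for the coefficients.
multiplicity : DottedComposition → Coefficients
multiplicity β γ = sumOver (𝟙 γ) (coarsenings β)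

mergeHead-vanish : ∀ q s γ δ → (∀ r → s ⊕ r ≢ just q) → maybe′ (𝟙 (q ∷ γ)) 0ℚ (mergeHead s δ) ≡ 0ℚ
mergeHead-vanish q s γ []      ne = refl
mergeHead-vanish q s γ (t ∷ δ) ne with s ⊕ t in eq
... | nothing = refl
... | just u  = 𝟙-∷-≢ {q} {u} γ δ (λ q≡u → ne t (trans eq (cong just (sym q≡u))))

-- A coarsening `δ` of the tail extends to `q ∷ γ` by keeping `s` when `q = s`, or by merging `s`
-- into its head `r` when `s ⊕ r = q`. The two cases exclude each other, and both say that `δ` is
-- `γ` preceded by what remains of `q` without `s`.
coarsen-step : ∀ q s γ δ →
  𝟙 (q ∷ γ) (s ∷ δ) ℚ.+ maybe′ (𝟙 (q ∷ γ)) 0ℚ (mergeHead s δ) ≡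
  maybe′ (λ r → 𝟙 (r ∷? γ) δ) 0ℚ (q ⊖ s)
coarsen-step q s γ δ with q ⊖ s | difference q s
... | _ | equal refl = trans
  (cong₂ ℚ._+_ (𝟙-∷ q γ δ) (mergeHead-vanish q s γ δ (λ r → ⊕≢ˡ q r))) (ℚP.+-identityʳ _)
... | _ | none q≢s ne = cong₂ ℚ._+_ (𝟙-∷-≢ γ δ q≢s) (mergeHead-vanish q s γ δ ne)
... | _ | rest r sr = trans
  (cong₂ ℚ._+_ (𝟙-∷-≢ {q} {s} γ δ (λ { refl → ⊕≢ˡ q r sr })) (merged δ)) (ℚP.+-identityˡ _)
  where
  merged : ∀ δ → maybe′ (𝟙 (q ∷ γ)) 0ℚ (mergeHead s δ) ≡ 𝟙 (r ∷ γ) δ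
  merged []      = refl
  -- By cancellation, `r` is the only head that merges with `s` to `q`.
  merged (t ∷ δ) with t ≟ r
  ... | yes refl = trans (cong (maybe′ (𝟙 (q ∷ γ)) 0ℚ) (mergeHead⁺ s t δ sr))
                         (trans (𝟙-∷ q γ δ) (sym (𝟙-∷ t γ δ)))
  ... | no t≢r with s ⊕ t in st
  ...   | nothing = sym (𝟙-∷-≢ γ δ (t≢r ∘ sym))
  ...   | just u  = trans
    (𝟙-∷-≢ {q} {u} γ δ λ { refl → t≢r (⊕-cancelˡ s t r st sr) }) (sym (𝟙-∷-≢ γ δ (t≢r ∘ sym)))

-- The same subtraction governs the splitting of a leading factor in a product; this coincidence
-- makes consecutive cuts cancel.
multiplicity-∷ : ∀ s β q γ →
  multiplicity (s ∷ β) (q ∷ γ) ≡ maybe′ (λ r → multiplicity β (r ∷? γ)) 0ℚ (q ⊖ s)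
multiplicity-∷ s β q γ = begin
  sumOver (𝟙 (q ∷ γ)) (coarsenings (s ∷ β))
    ≡⟨ sumOver-++ (𝟙 (q ∷ γ)) (map (s ∷_) (coarsenings β)) _ ⟩
  _ ≡⟨ cong₂ ℚ._+_ (sumOver-map (𝟙 (q ∷ γ)) (s ∷_) (coarsenings β))
         (sumOver-mapMaybe (𝟙 (q ∷ γ)) (mergeHead s) (coarsenings β)) ⟩
  _ ≡⟨ sym (sumOver-+ _ _ (coarsenings β)) ⟩
  _ ≡⟨ sumOver-cong (coarsen-step q s γ) (coarsenings β) ⟩
  sumOver (λ δ → maybe′ (λ r → 𝟙 (r ∷? γ) δ) 0ℚ (q ⊖ s)) (coarsenings β)
    ≡⟨ distribute (q ⊖ s) ⟩
  maybe′ (λ r → multiplicity β (r ∷? γ)) 0ℚ (q ⊖ s) ∎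
  where
  distribute : ∀ r → sumOver (λ δ → maybe′ (λ r → 𝟙 (r ∷? γ) δ) 0ℚ r) (coarsenings β) ≡
                     maybe′ (λ r → multiplicity β (r ∷? γ)) 0ℚ r
  distribute nothing  = sumOver-zero (λ _ → refl) (coarsenings β)
  distribute (just r) = refl

multiplicity-[] : ∀ s β → multiplicity (s ∷ β) [] ≡ 0ℚ
multiplicity-[] s β = begin
  _ ≡⟨ sumOver-++ (𝟙 []) (map (s ∷_) (coarsenings β)) _ ⟩
  _ ≡⟨ cong₂ ℚ._+_
         (trans (sumOver-map (𝟙 []) (s ∷_) (coarsenings β)) (sumOver-zero (λ _ → refl) (coarsenings β)))
         (trans (sumOver-mapMaybe (𝟙 []) (mergeHead s) (coarsenings β))
                (sumOver-zero merged (coarsenings β))) ⟩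
  0ℚ ∎
  where
  merged : ∀ δ → maybe′ (𝟙 []) 0ℚ (mergeHead s δ) ≡ 0ℚ
  merged []      = refl
  merged (t ∷ δ) with s ⊕ t
  ... | nothing = refl
  ... | just _  = refl

fermionicDegree-∷ : ∀ p γ → fermionicDegree (p ∷ γ) ≡ dots? (just p) 1 ℕ.+ fermionicDegree γ
fermionicDegree-∷ (plain _)  γ = refl
fermionicDegree-∷ (dotted _) γ = refl

fermionicDegree-merge : ∀ {s r q} γ → s ⊕ r ≡ just q →
  fermionicDegree (q ∷ γ) ≡ dots? (just s) 1 ℕ.+ fermionicDegree (r ∷ γ)
fermionicDegree-merge {plain _}  {plain _}  γ refl = refl
fermionicDegree-merge {plain _}  {dotted _} γ refl = refl
fermionicDegree-merge {dotted _} {plain _}  γ refl = refl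

-- Two dotted parts never merge, so coarsening preserves the fermionic degree. This makes the sign
-- in `twist` constant wherever the coefficient is nonzero.
multiplicity-support : ∀ β γ → fermionicDegree γ ≡ fermionicDegree β ⊎ multiplicity β γ ≡ 0ℚ
multiplicity-support []      []      = inj₁ refl
multiplicity-support []      (q ∷ γ) = inj₂ refl
multiplicity-support (s ∷ β) []      = inj₂ (multiplicity-[] s β)
multiplicity-support (s ∷ β) (q ∷ γ) rewrite multiplicity-∷ s β q γ | fermionicDegree-∷ s β
  with q ⊖ s | difference q s
... | _ | none _ _  = inj₂ refl
... | _ | equal refl = Sum.map₁
  (λ eq → trans (fermionicDegree-∷ q γ) (cong (dots? (just q) 1 ℕ.+_) eq)) (multiplicity-support β γ)
... | _ | rest r sr = Sum.map₁
  (λ eq → trans (fermionicDegree-merge γ sr) (cong (dots? (just s) 1 ℕ.+_) eq))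
  (multiplicity-support β (r ∷ γ))

-- Removing a dotted part uses up the only dot of `p`, so the remainder is plain or empty.
fermionicDegree-rest : ∀ p b r → p ⊖ dotted b ≡ just r → ∀ γ →
  fermionicDegree γ ≡ fermionicDegree (r ∷? γ)
fermionicDegree-rest p b r eq γ with p ⊖ dotted b | difference p (dotted b)
fermionicDegree-rest p b nothing          refl γ | _ | equal _          = refl
fermionicDegree-rest p b (just (plain _)) refl γ | _ | rest (plain _) _ = refl

twist-multiplicity : ∀ p g r β → p ⊖ g ≡ just r → ∀ γ →
  twist (just g) (multiplicity β ∘ (r ∷?_)) γ ≡
  -1^ dots? (just g) (fermionicDegree β) ℚ.* multiplicity β (r ∷? γ)
twist-multiplicity p (plain _)  r β pg γ = refl
twist-multiplicity p (dotted b) r β pg γ with multiplicity-support β (r ∷? γ)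
... | inj₁ eq = cong (λ n → -1^ n ℚ.* multiplicity β (r ∷? γ)) (trans (fermionicDegree-rest p b r pg γ) eq)
... | inj₂ eq rewrite eq =
  trans (ℚP.*-zeroʳ (-1^ fermionicDegree γ)) (sym (ℚP.*-zeroʳ (-1^ fermionicDegree β)))

-- The sign of the antipode.

antipodeSign : DottedComposition → ℚ
antipodeSign β = -1^ (length β ℕ.+ (fermionicDegree β C 2))

suc-C-2 : ∀ n → suc n C 2 ≡ n ℕ.+ (n C 2)
suc-C-2 n = trans (sym (nCk+nC[k+1]≡[n+1]C[k+1] n 1)) (cong (ℕ._+ (n C 2)) (nC1≡n n))

-- The minus sign comes from the length. A new dotted part raises the binomial coefficient by the
-- fermionic degree of `β`, by Pascal's rule, which is the exponent of the sign produced by `twist`.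
antipodeSign-∷ : ∀ g β → antipodeSign (g ∷ β) ≡
  ℚ.- (antipodeSign β ℚ.* -1^ dots? (just g) (fermionicDegree β))
antipodeSign-∷ (plain _)  β =
  solve 1 (λ x → :- con 1ℚ :* x := :- (x :* con 1ℚ)) refl (antipodeSign β)
  where open +-*-Solver
antipodeSign-∷ (dotted _) β = begin
  ℚ.- 1ℚ ℚ.* -1^ (length β ℕ.+ (suc n C 2))
    ≡⟨ cong (λ k → ℚ.- 1ℚ ℚ.* -1^ k) (trans (cong (length β ℕ.+_)
         (trans (suc-C-2 n) (ℕP.+-comm n (n C 2)))) (sym (ℕP.+-assoc (length β) (n C 2) n))) ⟩
  ℚ.- 1ℚ ℚ.* -1^ ((length β ℕ.+ (n C 2)) ℕ.+ n)
    ≡⟨ cong (ℚ.- 1ℚ ℚ.*_) (-1^-+ (length β ℕ.+ (n C 2)) n) ⟩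
  ℚ.- 1ℚ ℚ.* (antipodeSign β ℚ.* -1^ n)
    ≡⟨ solve 1 (λ x → :- con 1ℚ :* x := :- x) refl (antipodeSign β ℚ.* -1^ n) ⟩
  ℚ.- (antipodeSign β ℚ.* -1^ n) ∎
  where
  open +-*-Solver
  n = fermionicDegree β

antipodeSign-reverse : ∀ α → antipodeSign (reverse α) ≡ antipodeSign α
antipodeSign-reverse α = cong₂ (λ l n → -1^ (l ℕ.+ (n C 2))) (ListP.length-reverse α)
  (↭-length (filter-↭ _ (↭-reverse α)))

-- Telescoping over the cuts of a composition.

module _ {k i} .(k≤i : k ≤ i) (p : Part) (m : Monomial (suc i)) where

  -- The contribution to the coefficient in which the variables of index i come from
  -- the first factor only.
  leading : DottedComposition → DottedComposition → ℚ
  leading β γ = convolve m (multiplicity β ∘ (p ∷_)) (indicator γ)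

  leading-∷ : ∀ g β γ → leading (g ∷ β) γ ≡
    maybe′ (λ r → convolve m (multiplicity β ∘ (r ∷?_)) (indicator γ)) 0ℚ (p ⊖ g)
  leading-∷ g β γ = trans (convolve-congˡ m (indicator γ) (multiplicity-∷ g β p)) (distribute (p ⊖ g))
    where
    distribute : ∀ r →
      convolve m (λ δ → maybe′ (λ r → multiplicity β (r ∷? δ)) 0ℚ r) (indicator γ) ≡
      maybe′ (λ r → convolve m (multiplicity β ∘ (r ∷?_)) (indicator γ)) 0ℚ r
    distribute (just r) = refl
    distribute nothing  = convolve-zeroˡ m (λ _ → 0ℚ) (indicator γ) (λ _ → refl)

  -- In the second summand of `convolve-factor-∷` the twist is a constant sign, by
  -- `twist-multiplicity`; what is left is the leading contribution of the next cut, by `leading-∷`.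
  convolve-leading : ∀ β g γ →
    convolve (factor i k≤i p m) (multiplicity β) (indicator (g ∷ γ)) ≡
    leading β (g ∷ γ) ℚ.+ -1^ dots? (just g) (fermionicDegree β) ℚ.* leading (g ∷ β) γ
  convolve-leading β g γ = trans
    (convolve-factor-∷ i k≤i p m (multiplicity β) g γ)
    (cong (leading β (g ∷ γ) ℚ.+_)
      (trans (pull (p ⊖ g) refl) (cong (sign ℚ.*_) (sym (leading-∷ g β γ)))))
    where
    sign = -1^ dots? (just g) (fermionicDegree β)
    pull : ∀ r → p ⊖ g ≡ r →
      maybe′ (λ r → convolve m (twist (just g) (multiplicity β ∘ (r ∷?_))) (indicator γ)) 0ℚ r ≡
      sign ℚ.* maybe′ (λ r → convolve m (multiplicity β ∘ (r ∷?_)) (indicator γ)) 0ℚ r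
    pull nothing  eq = sym (ℚP.*-zeroʳ sign)
    pull (just r) eq = trans
      (convolve-congˡ m (indicator γ) (twist-multiplicity p g r β eq))
      (convolve-*ˡ m sign (multiplicity β ∘ (r ∷?_)) (indicator γ))

cuts : DottedComposition → List (DottedComposition × DottedComposition)
cuts []      = ([] , []) ∷ []
cuts (p ∷ α) = ([] , p ∷ α) ∷ map (Product.map₁ (p ∷_)) (cuts α)

sumOver-cuts-∷ : ∀ F p α → sumOver F (cuts (p ∷ α)) ≡
  F ([] , p ∷ α) ℚ.+ sumOver (F ∘ Product.map₁ (p ∷_)) (cuts α)
sumOver-cuts-∷ F p α = cong (F ([] , p ∷ α) ℚ.+_) (sumOver-map F (Product.map₁ (p ∷_)) (cuts α))

-- β is the reverse of what precedes the composition being cut.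
antipodeTerm : ∀ {k} → Monomial k → DottedComposition → DottedComposition × DottedComposition → ℚ
antipodeTerm m β (δ , γ) =
  antipodeSign (δ ʳ++ β) ℚ.* convolve m (multiplicity (δ ʳ++ β)) (indicator γ)

-- Induction on `γ` with the accumulator `β`: the induction hypothesis for `g ∷ β` is the leading
-- contribution of the next cut with the opposite sign, and cancels the second summand of
-- `convolve-leading`. The last cut has only a leading contribution.
antipodeTerms-factor : ∀ {k i} .(k≤i : k ≤ i) p m β γ →
  sumOver (antipodeTerm (factor i k≤i p m) β) (cuts γ) ≡ antipodeSign β ℚ.* leading k≤i p m β γ
antipodeTerms-factor {i = i} k≤i p m β [] = trans (ℚP.+-identityʳ _)
  (cong (antipodeSign β ℚ.*_) (convolve-factor-[] i k≤i p m (multiplicity β)))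
antipodeTerms-factor {i = i} k≤i p m β (g ∷ γ) = begin
  _ ≡⟨ sumOver-cuts-∷ (antipodeTerm (factor i k≤i p m) β) g γ ⟩
  _ ≡⟨ cong₂ ℚ._+_ (cong (e ℚ.*_) (convolve-leading k≤i p m β g γ))
         (trans (antipodeTerms-factor k≤i p m (g ∷ β) γ)
                (cong (ℚ._* leading k≤i p m (g ∷ β) γ) (antipodeSign-∷ g β))) ⟩
  e ℚ.* (D ℚ.+ s ℚ.* D′) ℚ.+ (ℚ.- (e ℚ.* s)) ℚ.* D′
    ≡⟨ solve 4 (λ e s D D′ → e :* (D :+ s :* D′) :+ (:- (e :* s)) :* D′ := e :* D) refl e s D D′ ⟩
  e ℚ.* D ∎
  where
  open +-*-Solver
  e  = antipodeSign β
  s  = -1^ dots? (just g) (fermionicDegree β)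
  D  = leading k≤i p m β (g ∷ γ)
  D′ = leading k≤i p m (g ∷ β) γ

antipodeTerm-one : ∀ {k} s β γ → antipodeTerm (one {k}) (s ∷ β) ([] , γ) ≡ 0ℚ
antipodeTerm-one {k} s β γ = begin
  _ ≡⟨ cong (antipodeSign (s ∷ β) ℚ.*_) (convolve-one {k} (multiplicity (s ∷ β)) (indicator γ)) ⟩
  antipodeSign (s ∷ β) ℚ.* (multiplicity (s ∷ β) [] ℚ.* 𝟙 [] γ)
    ≡⟨ cong (λ c → antipodeSign (s ∷ β) ℚ.* (c ℚ.* 𝟙 [] γ)) (multiplicity-[] s β) ⟩
  antipodeSign (s ∷ β) ℚ.* (0ℚ ℚ.* 𝟙 [] γ)
    ≡⟨ cong (antipodeSign (s ∷ β) ℚ.*_) (ℚP.*-zeroˡ (𝟙 [] γ)) ⟩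
  antipodeSign (s ∷ β) ℚ.* 0ℚ  ≡⟨ ℚP.*-zeroʳ (antipodeSign (s ∷ β)) ⟩
  0ℚ                           ∎

-- All prefixes here are nonempty, and a nonempty composition has no empty coarsening, so every
-- constant term is 0.
antipodeTerms-one : ∀ {k} s β γ → sumOver (antipodeTerm (one {k}) (s ∷ β)) (cuts γ) ≡ 0ℚ
antipodeTerms-one {k} s β [] = cong (ℚ._+ 0ℚ) (antipodeTerm-one {k} s β [])
antipodeTerms-one {k} s β (g ∷ γ) = trans
  (sumOver-cuts-∷ (antipodeTerm (one {k}) (s ∷ β)) g γ)
  (cong₂ ℚ._+_ (antipodeTerm-one {k} s β (g ∷ γ)) (antipodeTerms-one {k} g (s ∷ β) γ))

-- The right side is the coefficient of `m` in `unit (counit (M α))`: the claimed formula satisfies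
-- the left antipode identity.
antipodeTerms-total : ∀ (m : Monomial 1) α →
  sumOver (antipodeTerm m []) (cuts α) ≡ 𝟙 [] α ℚ.* 𝟙 (shape m) []
antipodeTerms-total (factor i k≤i p m) α = begin
  _ ≡⟨ antipodeTerms-factor k≤i p m [] α ⟩
  1ℚ ℚ.* leading k≤i p m [] α  ≡⟨ ℚP.*-identityˡ (leading k≤i p m [] α) ⟩
  -- Only the empty composition lies above the empty one, so `multiplicity []` vanishes on
  -- everything that starts with `p`.
  leading k≤i p m [] α         ≡⟨ convolve-zeroˡ m (multiplicity [] ∘ (p ∷_)) (indicator α) (λ _ → refl) ⟩
  0ℚ                           ≡⟨ sym (ℚP.*-zeroʳ (𝟙 [] α)) ⟩
  𝟙 [] α ℚ.* 0ℚ                ∎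
antipodeTerms-total one []      = refl
antipodeTerms-total one (p ∷ α) = trans
  (sumOver-cuts-∷ (antipodeTerm (one {1}) []) p α)
  (cong₂ ℚ._+_ refl (antipodeTerms-one {1} p [] α))

-- From coefficient functions to `sQSym`.

antipodeCoeff : DottedComposition → Coefficients
antipodeCoeff α γ = antipodeSign α ℚ.* multiplicity (reverse α) γ

coeff-∑M : ∀ γs m → coeff (∑ (map M γs)) m ≡ sumOver (𝟙 (shape m)) γs
coeff-∑M []       m = refl
coeff-∑M (γ ∷ γs) m = cong (𝟙 (shape m) γ ℚ.+_) (coeff-∑M γs m)

toCoefficients : sQSym → Coefficients
toCoefficients f γ = coeff f (consecutive 1 γ)

coeff-shape : ∀ f m → coeff f m ≡ toCoefficients f (shape m)
coeff-shape f m = quasisymmetric f m _ (sym (shape-consecutive 1 (shape m)))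

coeff-· : ∀ f γ m → coeff (f · M γ) m ≡ convolve m (toCoefficients f) (indicator γ)
coeff-· f γ m = sumOver-cong
  (λ (m₁ , m₂) → cong (λ c → signOf m₁ m₂ ℚ.* (c ℚ.* 𝟙 (shape m₂) γ)) (coeff-shape f m₁))
  (factorizations m)

coeff-mult : ∀ (F G : DottedComposition → sQSym) (αs : List (DottedComposition × DottedComposition)) m →
  coeff (mult (map (λ (β , γ) → F β , G γ) αs)) m ≡
  sumOver (λ (β , γ) → coeff (F β · G γ) m) αs
coeff-mult F G []       m = refl
coeff-mult F G ((β , γ) ∷ αs) m = cong (coeff (F β · G γ) m ℚ.+_) (coeff-mult F G αs m)

-- The coproduct of a basis element is deconcatenation.

cutTensor : DottedComposition → Tensor
cutTensor α = map (λ (β , γ) → M β , M γ) (cuts α)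

-- At most one cut of `α` has the halves `δ` and `ε`, and it exists exactly when they concatenate to
-- `α`.
sum-cuts-𝟙 : ∀ δ ε α → sumOver (λ (β , γ) → 𝟙 δ β ℚ.* 𝟙 ε γ) (cuts α) ≡ 𝟙 (δ ++ ε) α
sum-cuts-𝟙 [] ε []      = trans (ℚP.+-identityʳ _) (ℚP.*-identityˡ (𝟙 ε []))
sum-cuts-𝟙 (d ∷ δ) ε [] = trans (ℚP.+-identityʳ _) (ℚP.*-zeroˡ (𝟙 ε []))
sum-cuts-𝟙 [] ε (p ∷ α) = begin
  _ ≡⟨ sumOver-cuts-∷ (λ (β , γ) → 𝟙 [] β ℚ.* 𝟙 ε γ) p α ⟩
  _ ≡⟨ cong₂ ℚ._+_ (ℚP.*-identityˡ (𝟙 ε (p ∷ α)))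
         (sumOver-zero (λ (_ , γ) → ℚP.*-zeroˡ (𝟙 ε γ)) (cuts α)) ⟩
  _ ≡⟨ ℚP.+-identityʳ _ ⟩
  𝟙 ε (p ∷ α) ∎
sum-cuts-𝟙 (d ∷ δ) ε (p ∷ α) = begin
  _ ≡⟨ sumOver-cuts-∷ (λ (β , γ) → 𝟙 (d ∷ δ) β ℚ.* 𝟙 ε γ) p α ⟩
  _ ≡⟨ cong (ℚ._+ sumOver (λ (β , γ) → 𝟙 (d ∷ δ) (p ∷ β) ℚ.* 𝟙 ε γ) (cuts α))
         (ℚP.*-zeroˡ (𝟙 ε (p ∷ α))) ⟩
  _ ≡⟨ ℚP.+-identityˡ _ ⟩
  sumOver (λ (β , γ) → 𝟙 (d ∷ δ) (p ∷ β) ℚ.* 𝟙 ε γ) (cuts α) ≡⟨ cancel (d ≟ p) ⟩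
  𝟙 (d ∷ δ ++ ε) (p ∷ α) ∎
  where
  cancel : Dec (d ≡ p) →
    sumOver (λ (β , γ) → 𝟙 (d ∷ δ) (p ∷ β) ℚ.* 𝟙 ε γ) (cuts α) ≡ 𝟙 (d ∷ δ ++ ε) (p ∷ α)
  cancel (yes refl) = begin
    _ ≡⟨ sumOver-cong (λ (β , γ) → cong (ℚ._* 𝟙 ε γ) (𝟙-∷ d δ β)) (cuts α) ⟩
    _ ≡⟨ sum-cuts-𝟙 δ ε α ⟩
    _ ≡⟨ sym (𝟙-∷ d (δ ++ ε) α) ⟩
    _ ∎
  cancel (no d≢p) = trans
    (sumOver-zero (λ (β , γ) → trans (cong (ℚ._* 𝟙 ε γ) (𝟙-∷-≢ δ β d≢p)) (ℚP.*-zeroˡ (𝟙 ε γ))) (cuts α))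
    (sym (𝟙-∷-≢ (δ ++ ε) α d≢p))

cutTensor-IsΔ : ∀ α → cutTensor α IsΔ M α
cutTensor-IsΔ α m₁ m₂ = begin
  _ ≡⟨ sumOver-map _ (λ (β , γ) → M β , M γ) (cuts α) ⟩
  _ ≡⟨ sum-cuts-𝟙 (shape m₁) (shape m₂) α ⟩
  _ ≡⟨ cong (λ γ → 𝟙 γ α) (sym (shape-consecutive 1 (shape m₁ ++ shape m₂))) ⟩
  _ ∎

-- Determination of the antipode on basis elements.

-- Every cut but the last has a proper prefix as its first half, so those terms agree and can be
-- cancelled from the two sums.
cuts-cancel : ∀ α (F G : DottedComposition × DottedComposition → ℚ) →
  (∀ β γ → length β < length α → F (β , γ) ≡ G (β , γ)) →
  sumOver F (cuts α) ≡ sumOver G (cuts α) → F (α , []) ≡ G (α , [])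
cuts-cancel []      F G agree eq = ℚ+.∙-cancelʳ 0ℚ (F ([] , [])) (G ([] , [])) eq
cuts-cancel (p ∷ α) F G agree eq = cuts-cancel α (F ∘ shift) (G ∘ shift)
  (λ β γ lt → agree (p ∷ β) γ (s≤s lt))
  (ℚ+.∙-cancelˡ (F ([] , p ∷ α)) _ _ (begin
    F ([] , p ∷ α) ℚ.+ sumOver (F ∘ shift) (cuts α)  ≡⟨ sym (sumOver-cuts-∷ F p α) ⟩
    sumOver F (cuts (p ∷ α))                         ≡⟨ eq ⟩
    sumOver G (cuts (p ∷ α))                         ≡⟨ sumOver-cuts-∷ G p α ⟩
    G ([] , p ∷ α) ℚ.+ sumOver (G ∘ shift) (cuts α)
      ≡⟨ cong (ℚ._+ sumOver (G ∘ shift) (cuts α)) (sym (agree [] (p ∷ α) (s≤s z≤n))) ⟩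
    F ([] , p ∷ α) ℚ.+ sumOver (G ∘ shift) (cuts α)  ∎))
  where
  shift = Product.map₁ (p ∷_)

module _ (S : sQSym → sQSym) (isAntipode : IsAntipode S) where

  open IsAntipode isAntipode

  -- Both `S` and the claimed formula satisfy the left antipode identity at `M α`, so the two sums
  -- have the same value.
  antipode-sum : ∀ α m → sumOver (λ (β , γ) → coeff (S (M β) · M γ) m) (cuts α) ≡
                 sumOver (antipodeTerm m []) (cuts α)
  antipode-sum α m = begin
    _ ≡⟨ sym (coeff-mult (S ∘ M) M (cuts α) m) ⟩
    _ ≡⟨ cong (λ t → coeff (mult t) m) (map-∘ (cuts α)) ⟩
    coeff (mult ((S ⊗ id) (cutTensor α))) m ≡⟨ left (M α) (cutTensor α) (cutTensor-IsΔ α) m ⟩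
    𝟙 [] α ℚ.* 𝟙 (shape m) []               ≡⟨ sym (antipodeTerms-total m α) ⟩
    sumOver (antipodeTerm m []) (cuts α)    ∎

  antipodeTerm-reverse : ∀ m β γ → antipodeTerm m [] (β , γ) ≡
    convolve {1} m (antipodeCoeff β) (indicator γ)
  antipodeTerm-reverse m β γ = trans
    (cong (ℚ._* convolve m (multiplicity (reverse β)) (indicator γ)) (antipodeSign-reverse β))
    (sym (convolve-*ˡ m (antipodeSign β) (multiplicity (reverse β)) (indicator γ)))

  -- Strong induction on the length, bounded by `n`: the values on proper prefixes are known, and
  -- the left identity then fixes the remaining term.
  antipode-coeff : ∀ n α → length α < n → ∀ m → coeff (S (M α)) m ≡ antipodeCoeff α (shape m)
  antipode-coeff (suc n) α (s≤s lt) m = begin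
    coeff (S (M α)) m                  ≡⟨ coeff-shape (S (M α)) m ⟩
    -- Multiplying by `M [] = 1` turns the coefficient into the term of the cut `(α , [])`.
    toCoefficients (S (M α)) (shape m) ≡⟨ sym (convolve-identityʳ m (toCoefficients (S (M α)))) ⟩
    _                                  ≡⟨ sym (coeff-· (S (M α)) [] m) ⟩
    coeff (S (M α) · M []) m           ≡⟨ cuts-cancel α _ (antipodeTerm m []) agree (antipode-sum α m) ⟩
    antipodeTerm m [] (α , [])         ≡⟨ antipodeTerm-reverse m α [] ⟩
    _                                  ≡⟨ convolve-identityʳ m (antipodeCoeff α) ⟩
    antipodeCoeff α (shape m)          ∎
    where
    agree : ∀ β γ → length β < length α → coeff (S (M β) · M γ) m ≡ antipodeTerm m [] (β , γ)
    agree β γ β<α = begin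
      _ ≡⟨ coeff-· (S (M β)) γ m ⟩
      _ ≡⟨ convolve-congˡ m (indicator γ)
             (λ δ → trans (antipode-coeff n β (ℕP.<-≤-trans β<α lt) (consecutive 1 δ))
                          (cong (antipodeCoeff β) (shape-consecutive 1 δ))) ⟩
      _ ≡⟨ sym (antipodeTerm-reverse m β γ) ⟩
      _ ∎

proposition5p10 : (S : sQSym → sQSym) → IsAntipode S →
    (α : DottedComposition) →
    S (M α) ≈ ((ℚ.- 1ℚ) ^ (length α ℕ.+ (fermionicDegree α C 2))) • (∑[ above (reverse α) ] M)
proposition5p10 S isAntipode α m = trans
  (antipode-coeff S isAntipode (suc (length α)) α ℕP.≤-refl m)
  (cong (antipodeSign α ℚ.*_) (sym (coeff-∑M (coarsenings (reverse α)) m)))
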